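{- Let $k\ge 1$, $n\ge 1$, let $\mathbf r=(r_1,\dots,r_k)$ with $0\le r_1\le\dots\le r_k\le n$, and let $\mathbf S=(S_1,\dots,S_{k-1})$ with $S_i\subseteq[n]$. Let $\boldsymbol\mu=(\mu_1,\dots,\mu_k)$ be a sequence of valuated matroids on $[n]$, where $\mu_i$ has rank $r_i$. The following are equivalent: (a) $\boldsymbol\mu\in\operatorname{LFlDr}(\mathbf r,\mathbf S;n)$; (b) $\boldsymbol\mu$ is a linear degenerate valuated flag matroid of degeneration type $\mathbf S$, i.e. $(\mu_i)_{S_i}\twoheadleftarrow\mu_{i+1}$ for all $i\in\{1,\dots,k-1\}$; (c) $\mathrm{pr}^{\operatorname{trop}}_{S_i}\big(\overline{\operatorname{trop}}(\mu_i)\big)\subseteq\overline{\operatorname{trop}}(\mu_{i+1})$ for all $i\in\{1,\dots,k-1\}$; (d) for every $i\in\{1,\dots,k-1\}$, the projection $\mathrm{pr}_{S_i}:\mu_{i+1}\to\mu_i$ is a morphism of valuated matroids.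
   Context: Tropical conventions: $\mathbb T=\mathbb R\cup\{\infty\}$ with $a\oplus b=\min(a,b)$, $a\odot b=a+b$. $\mathbb P(\mathbb T^N)=(\mathbb T^N\setminus\{(\infty,\dots,\infty)\})/\mathbb R\mathbf 1$. For a tropical polynomial $F=\bigoplus_u c_u\odot x^u$, its tropical hypersurface $V(F)$ is the set of points where $\min_u\{c_u+\sum_i u_ix_i\}$ is attained at least twice, with the convention that it counts as attained twice if the minimum is $\infty$. A valuated matroid of rank $r$ on $[n]$ is a map $\nu:\binom{[n]}{r}\to\mathbb T$, not identically $\infty$, such that for all $I,J\in\binom{[n]}{r}$ and $i\in I\setminus J$ there is $j\in J\setminus I$ with $\nu(I)+\nu(J)\ge\nu((I\setminus i)\cup j)+\nu((J\setminus j)\cup i)$. Valuated matroids differing by an additive real constant are identified, so $\nu$ is a point of $\mathbb P(\mathbb T^{\binom nr})$. Its underlying matroid has as bases the $B$ with $\nu(B)\ne\infty$. Quotient: for valuated matroids $\mu,\nu$ on $[n]$ of ranks $r\le s$, $\mu\twoheadleftarrow\nu$ means: for all $I\in\binom{[n]}r$, $J\in\binom{[n]}s$, $i\in I\setminus J$ there is $j\in J\setminus I$ with $\mu(I)+\nu(J)\ge\mu(I\cup j\setminus i)+\nu(J\cup i\setminus j)$. Tropical linear space: for $\mu$ of rank $r$ and $I\in\binom{[n]}{r+1}$ let $C_\mu(I)\in\mathbb T^n$ have $C_\mu(I)_i=\mu(I\setminus i)$ for $i\in I$ and $\infty$ otherwise; the valuated circuits are the images in $\mathbb P(\mathbb T^n)$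 of those $C_\mu(I)$ not equal to $(\infty,\dots,\infty)$. $\overline{\operatorname{trop}}(\mu)=\bigcap_{C}V(\bigoplus_{i\in[n]}C_i\odot x_i)\subseteq\mathbb P(\mathbb T^n)$, over all valuated circuits $C$. Tropical projection: for $S\subseteq[n]$, $\mathrm{pr}^{\operatorname{trop}}_S:\mathbb T^n\to\mathbb T^n$ sets coordinates in $S$ to $\infty$ and keeps the others; for $X\subseteq\mathbb P(\mathbb T^n)$, $\mathrm{pr}^{\operatorname{trop}}_S(X)$ is the image in $\mathbb P(\mathbb T^n)$ of $\mathrm{pr}^{\operatorname{trop}}_S(\varphi^{ -1}(X))\setminus\{(\infty,\dots,\infty)\}$, where $\varphi$ is the quotient map. Deletion and $\mu_S$: let $\mu$ have rank $r$ and underlying matroid $M$, $S\subseteq[n]$, $k=\operatorname{rk}(M\setminus S)$. Choose $I\subseteq S$ with $|I|=r-k$ such that $([n]\setminus S)\cup I$ has rank $r$ in $M$. Then $\mu_S:\binom{[n]}{k}\to\mathbb T$ is $\mu_S(B)=\mu(B\cup I)$ if $B\cap S=\emptyset$ and $\infty$ otherwise; this is a valuated matroid on $[n]$, independent of the choice of $I$ up to equivalence (the deletion $\mu\setminus S$ with the elements of $S$ added as loops). Linear degenerate flag Dressian: for $S\subseteq[n]$ and $r\le s$, $\mathscr P^{\operatorname{trop}}_{r,s;S;n}$ is the set of tropical polynomials $\bigoplus_{j\in J\setminus(I\cup S)}p_{I\cup j}\odot p_{J\setminus j}$ for $I\in\binom{[n]}{r-1}$, $J\in\binom{[n]}{s+1}$,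 in variables $p_I$ ($I\in\binom{[n]}r$) and $p_J$ ($J\in\binom{[n]}s$); $\mathscr P^{\operatorname{trop}}_{r;n}:=\mathscr P^{\operatorname{trop}}_{r,r;\emptyset;n}$ (tropical Grassmann–Plücker relations). With $S_{ij}=S_i\cup\dots\cup S_{j-1}$, $\operatorname{LFlDr}(\mathbf r,\mathbf S;n)\subseteq\prod_{i=1}^k\mathbb P(\mathbb T^{\binom n{r_i}})$ is the intersection of the tropical hypersurfaces of all polynomials in $\mathscr P^{\operatorname{trop}}_{r_i;n}$ ($1\le i\le k$) and $\mathscr P^{\operatorname{trop}}_{r_i,r_j;S_{ij};n}$ ($1\le i<j\le k$). Morphisms: for a valuated matroid $\mu$ on a ground set $E$ and a new element $o$, $\mu_o=\mu\oplus U_{0,1}$ is $\mu$ on $E\cup\{o\}$ with $o$ a loop (same bases and values). For a surjective map $f:[m]\to[n]$ and $\nu$ of rank $r$ on $[n]$ with underlying matroid $N$, $f^{ -1}(\nu)(I)=\nu(f(I))$ if $f(I)$ is a basis of $N$ with $|f(I)|=|I|$, and $\infty$ otherwise; for a general map $f$, $f^{ -1}(\nu):=f^{ -1}(\nu|_{f([m])})$ where $\nu|_{T}$ is the deletion of the complement of $T$. For $\mu$ on $[m]$ and $\nu$ on $[n]$, a map $f:[m]\cup\{o\}\to[n]\cup\{o\}$ with $f(o)=o$ is a morphism of valuated matroids $f:\mu\to\nu$ if $f^{ -1}(\nu_o)\twoheadleftarrow\mu_o$. The projection $\mathrm{pr}_S:[n]\cup\{o\}\to[n]\cup\{o\}$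 fixes elements outside $S$ and sends elements of $S$ (and $o$) to $o$. -}

module Defs where

open import Level using (0ℓ)
open import Data.Nat as ℕ using (ℕ; zero; suc; _∸_; _≡ᵇ_)
  renaming (_≤_ to _≤ℕ_; _<_ to _<ℕ_; _≤?_ to _≤ℕ?_; _<?_ to _<ℕ?_)
open import Data.Bool using (Bool; true; false; if_then_else_; _∧_; _∨_; not)
open import Data.Fin using (Fin; zero; suc; toℕ; inject₁)
open import Data.Fin.Properties using (any?; _≟_)
open import Data.Fin.Subset
  using (Subset; _∈_; _∉_; _⊆_; _∩_; _∪_; ∁; ⋃; _-_; ∣_∣; ⁅_⁆; Empty; Nonempty; ⊤; ⊥)
open import Data.Fin.Subset.Properties using (_∈?_)
open import Data.Vec using (Vec; _∷_; []; lookup; tabulate)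
open import Data.List using (List; map; filter; allFin)
open import Data.Sum using (_⊎_)
open import Data.Product using (Σ; ∃; _×_; _,_)
open import Relation.Binary.PropositionalEquality using (_≡_; _≢_)
open import Relation.Binary.Structures using (IsDecTotalOrder)
open import Relation.Binary.Core using (Rel)
open import Relation.Nullary using (¬_)
open import Relation.Nullary.Decidable using (⌊_⌋; _×-dec_)
open import Algebra.Structures using (IsCommutativeRing)

-- The real numbers, axiomatised as a Dedekind-complete ordered field
-- (these axioms characterise ℝ up to isomorphism).  The order is
-- assumed decidable (classical reals).

record RealField : Set₁ where
  infixl 6 _+_
  infixl 7 _*_
  infix  4 _≤_
  field
    Carrier : Set
    _+_ _*_ : Carrier → Carrier → Carrier
    -_      : Carrier → Carrier
    0# 1#   : Carrier
    _≤_     : Rel Carrier 0ℓ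
    isCommutativeRing : IsCommutativeRing _≡_ _+_ _*_ -_ 0# 1#
    0≢1      : 0# ≢ 1#
    inverse  : ∀ x → x ≢ 0# → ∃ λ y → x * y ≡ 1#
    isDecTotalOrder : IsDecTotalOrder _≡_ _≤_
    +-monoˡ-≤ : ∀ {x y} z → x ≤ y → x + z ≤ y + z
    *-nonneg  : ∀ {x y} → 0# ≤ x → 0# ≤ y → 0# ≤ x * y
    sup : (P : Carrier → Set) → (∃ P) → (∃ λ u → ∀ x → P x → x ≤ u) →
          ∃ λ s → (∀ x → P x → x ≤ s) × (∀ u → (∀ x → P x → x ≤ u) → s ≤ u)

module Tropical (R : RealField) where
  open RealField R renaming (Carrier to ℝ)

  data 𝕋 : Set where
    fin : ℝ → 𝕋
    ∞   : 𝕋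

  infixl 6 _⊙_
  _⊙_ : 𝕋 → 𝕋 → 𝕋
  fin a ⊙ fin b = fin (a + b)
  _     ⊙ _     = ∞

  infix 4 _≤T_
  data _≤T_ : 𝕋 → 𝕋 → Set where
    fin≤fin : ∀ {a b} → a ≤ b → fin a ≤T fin b
    _≤∞     : ∀ x → x ≤T ∞

  -- Membership in a tropical hypersurface, given the (evaluated) terms
  -- t_a (a : Fin m) of a tropical polynomial ⊕_a t_a at a point: the
  -- minimum is attained at least twice, or the minimum is ∞.
  InV : ∀ {m} → (Fin m → 𝕋) → Set
  InV {m} t = (∀ a → t a ≡ ∞)
            ⊎ (∃ λ a → ∃ λ b → (a ≢ b) × (t a ≡ t b) × (∀ c → t a ≤T t c))

  -- Valuated matroids.  A valuation of rank r on [n] = Fin n is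
  -- represented by a function on all subsets; only its values on
  -- r-subsets are meaningful.  Representatives are used in place of
  -- points of the projective space (all notions below are invariant
  -- under adding a real constant).

  Val : ℕ → Set
  Val n = Subset n → 𝕋

  IsValuatedMatroid : ∀ {n} → ℕ → Val n → Set
  IsValuatedMatroid {n} r ν =
    (∃ λ (I : Subset n) → ∣ I ∣ ≡ r × ν I ≢ ∞) ×
    (∀ (I J : Subset n) (i : Fin n) → ∣ I ∣ ≡ r → ∣ J ∣ ≡ r → i ∈ I → i ∉ J →
       ∃ λ j → j ∈ J × j ∉ I ×
         (ν ((I - i) ∪ ⁅ j ⁆) ⊙ ν ((J - j) ∪ ⁅ i ⁆) ≤T ν I ⊙ ν J))

  Quotient : ∀ {n} → ℕ → ℕ → Val n → Val n → Set
  Quotient {n} r s μ ν =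
    ∀ (I J : Subset n) (i : Fin n) → ∣ I ∣ ≡ r → ∣ J ∣ ≡ s → i ∈ I → i ∉ J →
       ∃ λ j → j ∈ J × j ∉ I ×
         (μ ((I - i) ∪ ⁅ j ⁆) ⊙ ν ((J - j) ∪ ⁅ i ⁆) ≤T μ I ⊙ ν J)

  Basis : ∀ {n} → ℕ → Val n → Subset n → Set
  Basis r ν B = ∣ B ∣ ≡ r × ν B ≢ ∞

  HasRank : ∀ {n} → ℕ → Val n → Subset n → ℕ → Set
  HasRank r ν A k =
    (∃ λ B → Basis r ν B × ∣ A ∩ B ∣ ≡ k) ×
    (∀ B → Basis r ν B → ∣ A ∩ B ∣ ≤ℕ k)

  -- IsMuS r ν S k δ : δ is (a representative of) ν_S, i.e. the deletion
  -- ν ∖ S with the elements of S added back as loops, of rank k,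
  -- constructed from an admissible choice of I ⊆ S.
  IsMuS : ∀ {n} → ℕ → Val n → Subset n → ℕ → Val n → Set
  IsMuS {n} r ν S k δ =
    HasRank r ν (∁ S) k ×
    ∃ λ (I : Subset n) → I ⊆ S × ∣ I ∣ ≡ r ∸ k × HasRank r ν (∁ S ∪ I) r ×
      (∀ B → Empty (B ∩ S) → δ B ≡ ν (B ∪ I)) ×
      (∀ B → Nonempty (B ∩ S) → δ B ≡ ∞)

  NonZeroPt : ∀ {n} → (Fin n → 𝕋) → Set
  NonZeroPt x = ∃ λ i → x i ≢ ∞

  circuit : ∀ {n} → Val n → Subset n → Fin n → 𝕋
  circuit μ I i = if lookup I i then μ (I - i) else ∞

  -- x ∈ trop‾(μ) for μ of rank r (x a representative of a point of ℙ(𝕋ⁿ))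
  TropLin : ∀ {n} → ℕ → Val n → (Fin n → 𝕋) → Set
  TropLin {n} r μ x =
    NonZeroPt x ×
    (∀ (I : Subset n) → ∣ I ∣ ≡ suc r → (∃ λ i → circuit μ I i ≢ ∞) →
       InV (λ i → circuit μ I i ⊙ x i))

  prTrop : ∀ {n} → Subset n → (Fin n → 𝕋) → Fin n → 𝕋
  prTrop S x i = if lookup S i then ∞ else x i

  ProjTrop : ∀ {n} → Subset n → ((Fin n → 𝕋) → Set) → (Fin n → 𝕋) → Set
  ProjTrop S X y = NonZeroPt y × ∃ λ x → X x × (∀ i → prTrop S x i ≡ y i)

  -- Tropical (incidence) Plücker relations 𝒫^trop_{r,s;S;n}, evaluated
  -- at p = μ (for the r-sets) and p = ν (for the s-sets); the terms are
  -- indexed by j ∈ J ∖ (I ∪ S), other indices contribute ∞.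

  PluckerHolds : ∀ {n} → ℕ → ℕ → Subset n → Val n → Val n → Set
  PluckerHolds {n} r s S μ ν =
    ∀ (I J : Subset n) → suc ∣ I ∣ ≡ r → ∣ J ∣ ≡ suc s →
      InV (λ j → if lookup J j ∧ not (lookup I j ∨ lookup S j)
                 then μ (I ∪ ⁅ j ⁆) ⊙ ν (J - j) else ∞)

  Sunion : ∀ {n m} → (Fin m → Subset n) → Fin (suc m) → Fin (suc m) → Subset n
  Sunion {n} {m} S i j =
    ⋃ (map S (filter (λ l → (toℕ i ≤ℕ? toℕ l) ×-dec (toℕ l <ℕ? toℕ j)) (allFin m)))

  -- Flags have length k = suc m (so k ≥ 1); the i-th consecutive pair
  -- (i : Fin m) is (inject₁ i , suc i).

  InLFlDr : ∀ {n m} → (Fin (suc m) → ℕ) → (Fin m → Subset n) →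
            (Fin (suc m) → Val n) → Set
  InLFlDr r S μ =
    (∀ i → PluckerHolds (r i) (r i) ⊥ (μ i) (μ i)) ×
    (∀ i j → toℕ i <ℕ toℕ j → PluckerHolds (r i) (r j) (Sunion S i j) (μ i) (μ j))

  IsLinDegFlag : ∀ {n m} → (Fin (suc m) → ℕ) → (Fin m → Subset n) →
                 (Fin (suc m) → Val n) → Set
  IsLinDegFlag r S μ =
    ∀ i k δ → IsMuS (r (inject₁ i)) (μ (inject₁ i)) (S i) k δ →
      Quotient k (r (suc i)) δ (μ (suc i))

  ProjContained : ∀ {n m} → (Fin (suc m) → ℕ) → (Fin m → Subset n) →
                  (Fin (suc m) → Val n) → Set
  ProjContained r S μ =
    ∀ i y → ProjTrop (S i) (TropLin (r (inject₁ i)) (μ (inject₁ i))) y →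
      TropLin (r (suc i)) (μ (suc i)) y

  -- Morphisms.  [n] ∪ {o} is Fin (suc n) with o = zero and j ↦ suc j.

  loopExt : ∀ {n} → Val n → Val (suc n)
  loopExt μ (true  ∷ B) = ∞
  loopExt μ (false ∷ B) = μ B

  prMap : ∀ {n} → Subset n → Fin (suc n) → Fin (suc n)
  prMap S zero    = zero
  prMap S (suc j) = if lookup S j then zero else suc j

  image : ∀ {m n} → (Fin m → Fin n) → Subset m → Subset n
  image f I = tabulate (λ j → ⌊ any? (λ i → (i ∈? I) ×-dec (f i ≟ j)) ⌋)

  -- f⁻¹(δ) for δ a valuated matroid of rank k supported on the image of f
  -- (f regarded as a surjection onto its image)
  preimage : ∀ {m n} → ℕ → (Fin m → Fin n) → Val n → Val m
  preimage k f δ I =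
    if (∣ image f I ∣ ≡ᵇ ∣ I ∣) ∧ (∣ image f I ∣ ≡ᵇ k) then δ (image f I) else ∞

  -- f : μ → ν is a morphism (μ on [m] of rank s, ν on [n] of rank r):
  -- f⁻¹(ν_o) ↞ μ_o, where f⁻¹(ν_o) := f⁻¹(ν_o|_{f([m]∪o)}) and the
  -- restriction is the deletion of the complement of the image.
  IsMorphism : ∀ {m n} → (Fin (suc m) → Fin (suc n)) →
               ℕ → Val m → ℕ → Val n → Set
  IsMorphism f s μ r ν =
    f zero ≡ zero ×
    (∀ k δ → IsMuS r (loopExt ν) (∁ (image f ⊤)) k δ →
       Quotient k s (preimage k f δ) (loopExt μ))

  ProjMorphisms : ∀ {n m} → (Fin (suc m) → ℕ) → (Fin m → Subset n) →
                  (Fin (suc m) → Val n) → Set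
  ProjMorphisms r S μ =
    ∀ i → IsMorphism (prMap (S i)) (r (suc i)) (μ (suc i))
                     (r (inject₁ i)) (μ (inject₁ i))

{-# OPTIONS --safe #-}
module Submission where

-- All four conditions are compared with the containment saying that the projection along S
-- of every vector of μ is a vector of ν.  The vectors j ↦ μ (I ∪ j) lie in trop(μ), and
-- containment of their projections is the incidence relation; such containments compose along
-- the flag, which reduces (a) to consecutive pairs.  Circuits of μ_S are circuits of μ, so projected vectors
-- of μ are vectors of μ_S.  Finally, let δ ↞ ν, let y be a vector of δ and let
-- ν (J - a) + y a be finite.  Some basis B of δ minimising δ B - Σ_{i ∈ B} yᵢ contains a, since
-- the circuit in B ∪ a attains its minimum twice; exchanging a between B and J - a yields
-- b ≠ a with ν (J - b) + y b ≤ ν (J - a) + y a, because B is optimal.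

open import Defs
open import Algebra.Bundles using (CommutativeMonoid; CommutativeRing)
import Algebra.Properties.CommutativeSemigroup as CommutativeSemigroupProperties
open import Algebra.Solver.Ring.AlmostCommutativeRing using (fromCommutativeRing)
import Algebra.Solver.Ring.Simple as RingSolver
open import Data.Bool using (Bool; true; false; if_then_else_; _∨_; _∧_; not)
open import Data.Bool.Properties using (∨-identityʳ; ∧-zeroʳ)
open import Data.Fin as F using (Fin; zero; suc; inject₁; fromℕ; toℕ)
open import Data.Fin.Induction using (<-weakInduction)
open import Data.Fin.Properties using (_≟_; any?; toℕ-inject₁; toℕ-injective)
open import Data.Fin.Subset
  using (Subset; inside; outside; _∈_; _∉_; _⊆_; _∩_; _∪_; ∁; ⋃; _-_; ∣_∣; ⁅_⁆; Empty; Nonempty; ⊥; ⊤)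
open import Data.Fin.Subset.Properties
open import Data.List using (List; []; _∷_; _++_; filter; allFin)
import Data.List as List
import Data.List.Extrema as Extrema
open import Data.List.Membership.Propositional using () renaming (_∈_ to _∈ₗ_)
open import Data.List.Membership.Propositional.Properties
  using (∈-++⁺ˡ; ∈-++⁺ʳ; ∈-map⁺; ∈-map⁻; ∈-filter⁺; ∈-filter⁻; ∈-allFin)
open import Data.List.Relation.Unary.All using (lookup)
open import Data.List.Relation.Unary.All.Properties using (all-filter)
open import Data.List.Relation.Unary.Any using (here; there)
open import Data.Nat as ℕ using (ℕ; zero; suc; _≤_; s≤s)
import Data.Nat.Properties as ℕ
open import Data.Product using (∃; _×_; _,_; proj₁; proj₂)
open import Data.Sum using (_⊎_; inj₁; inj₂; [_,_]′)
open import Data.Unit using (tt)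
open import Data.Vec using ([]; _∷_; here; there)
import Data.Vec as Vec
open import Data.Vec.Properties using ([]=⇒lookup; lookup⇒[]=; lookup∘tabulate)
open import Function using (_∘_)
open import Function.Bundles using (_⇔_; mk⇔)
open import Relation.Binary.Bundles using (TotalOrder)
open import Relation.Binary.PropositionalEquality
open import Relation.Binary.Structures using (IsDecTotalOrder)
open import Relation.Nullary using (Dec; yes; no; contradiction; ¬?)
open import Relation.Nullary.Decidable using (_×-dec_; ⌊_⌋; dec-true; isYes≗does)
open import Relation.Unary using (Decidable)

-- Finite subsets: insertion, removal, exchange and cardinality.

private
  variable
    n : ℕ
    p q : Subset n
    x y : Fin n

x∉p-x : x ∉ p - x
x∉p-x {x = zero}  {p = s ∷ p} ()
x∉p-x {x = suc x} {p = s ∷ p} (there h) = x∉p-x h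

x∈p-y⇒x∈p : x ∈ p - y → x ∈ p
x∈p-y⇒x∈p {p = p} = p─q⊆p p _

x∈p-y⇒x≢y : x ∈ p - y → x ≢ y
x∈p-y⇒x≢y h refl = x∉p-x h

x∈p∪⁅x⁆ : x ∈ p ∪ ⁅ x ⁆
x∈p∪⁅x⁆ {x = x} {p} = q⊆p∪q p ⁅ x ⁆ (x∈⁅x⁆ x)

x∈p∪⁅y⁆∧x≢y⇒x∈p : x ∈ p ∪ ⁅ y ⁆ → x ≢ y → x ∈ p
x∈p∪⁅y⁆∧x≢y⇒x∈p {p = p} {y} h x≢y with x∈p∪q⁻ p ⁅ y ⁆ h
... | inj₁ x∈p = x∈p
... | inj₂ x∈y = contradiction (x∈⁅y⁆⇒x≡y y x∈y) x≢y

∪-remove : ∀ (p q : Subset n) → x ∉ q → (p ∪ q) - x ≡ (p - x) ∪ q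
∪-remove {x = x} p q x∉q = ⊆-antisym to from
  where
  to : (p ∪ q) - x ⊆ (p - x) ∪ q
  to h with x∈p∪q⁻ p q (x∈p-y⇒x∈p h)
  ... | inj₁ y∈p = p⊆p∪q q (x∈p∧x≢y⇒x∈p-y y∈p (x∈p-y⇒x≢y h))
  ... | inj₂ y∈q = q⊆p∪q (p - x) q y∈q
  from : (p - x) ∪ q ⊆ (p ∪ q) - x
  from h with x∈p∪q⁻ (p - x) q h
  ... | inj₁ y∈p = x∈p∧x≢y⇒x∈p-y (p⊆p∪q q (x∈p-y⇒x∈p y∈p)) (x∈p-y⇒x≢y y∈p)
  ... | inj₂ y∈q = x∈p∧x≢y⇒x∈p-y (q⊆p∪q p q y∈q) λ { refl → x∉q y∈q }

insert-remove : x ∉ p → (p ∪ ⁅ x ⁆) - x ≡ p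
insert-remove {x = x} {p} x∉p = ⊆-antisym
  (λ h → x∈p∪⁅y⁆∧x≢y⇒x∈p (x∈p-y⇒x∈p h) (x∈p-y⇒x≢y h))
  (λ y∈p → x∈p∧x≢y⇒x∈p-y (p⊆p∪q ⁅ x ⁆ y∈p) λ { refl → x∉p y∈p })

remove-insert : x ∈ p → (p - x) ∪ ⁅ x ⁆ ≡ p
remove-insert {x = x} {p} x∈p = ⊆-antisym to from
  where
  to : (p - x) ∪ ⁅ x ⁆ ⊆ p
  to h with x∈p∪q⁻ (p - x) ⁅ x ⁆ h
  ... | inj₁ y∈p = x∈p-y⇒x∈p y∈p
  ... | inj₂ y∈x with refl ← x∈⁅y⁆⇒x≡y x y∈x = x∈p
  from : p ⊆ (p - x) ∪ ⁅ x ⁆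
  from {y} y∈p with y ≟ x
  ... | yes refl = x∈p∪⁅x⁆
  ... | no  y≢x  = p⊆p∪q ⁅ x ⁆ (x∈p∧x≢y⇒x∈p-y y∈p y≢x)

∪-swapʳ : ∀ (p q r : Subset n) → (p ∪ q) ∪ r ≡ (p ∪ r) ∪ q
∪-swapʳ p q r = trans (∪-assoc p q r) (trans (cong (p ∪_) (∪-comm q r)) (sym (∪-assoc p r q)))

∩-∁-partition : ∀ (p q : Subset n) → (∁ p ∩ q) ∪ (p ∩ q) ≡ q
∩-∁-partition p q = trans (sym (∩-distribʳ-∪ q (∁ p) p))
  (trans (cong (_∩ q) (trans (∪-comm (∁ p) p) (p∪∁p≡⊤ p))) (∩-identityˡ q))

∣disjoint-∪∣ : (∀ {x} → x ∈ p → x ∉ q) → ∣ p ∪ q ∣ ≡ ∣ p ∣ ℕ.+ ∣ q ∣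
∣disjoint-∪∣ {p = []} {[]} d = refl
∣disjoint-∪∣ {p = outside ∷ p} {outside ∷ q} d = ∣disjoint-∪∣ λ a b → d (there a) (there b)
∣disjoint-∪∣ {p = outside ∷ p} {inside ∷ q} d =
  trans (cong suc (∣disjoint-∪∣ λ a b → d (there a) (there b))) (sym (ℕ.+-suc ∣ p ∣ ∣ q ∣))
∣disjoint-∪∣ {p = inside ∷ p} {outside ∷ q} d = cong suc (∣disjoint-∪∣ λ a b → d (there a) (there b))
∣disjoint-∪∣ {p = inside ∷ p} {inside ∷ q} d = contradiction here (d here)

∣insert∣ : x ∉ p → ∣ p ∪ ⁅ x ⁆ ∣ ≡ suc ∣ p ∣
∣insert∣ {x = x} {p} x∉p = trans (∣disjoint-∪∣ disj)
  (trans (cong (∣ p ∣ ℕ.+_) (∣⁅x⁆∣≡1 x)) (ℕ.+-comm ∣ p ∣ 1))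
  where
  disj : ∀ {y} → y ∈ p → y ∉ ⁅ x ⁆
  disj y∈p y∈x with refl ← x∈⁅y⁆⇒x≡y x y∈x = x∉p y∈p

∣remove∣ : x ∈ p → suc ∣ p - x ∣ ≡ ∣ p ∣
∣remove∣ {p = p} x∈p = trans (sym (∣insert∣ (x∉p-x {p = p}))) (cong ∣_∣ (remove-insert x∈p))

∣exchange∣ : x ∈ p → y ∉ p → ∣ (p - x) ∪ ⁅ y ⁆ ∣ ≡ ∣ p ∣
∣exchange∣ x∈p y∉p = trans (∣insert∣ (y∉p ∘ x∈p-y⇒x∈p)) (∣remove∣ x∈p)

∣∁p∩q∣+∣p∩q∣ : ∀ (p q : Subset n) → ∣ ∁ p ∩ q ∣ ℕ.+ ∣ p ∩ q ∣ ≡ ∣ q ∣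
∣∁p∩q∣+∣p∩q∣ p q = trans (sym (∣disjoint-∪∣ disj)) (cong ∣_∣ (∩-∁-partition p q))
  where
  disj : ∀ {x} → x ∈ ∁ p ∩ q → x ∉ p ∩ q
  disj a b = x∈∁p⇒x∉p (proj₁ (x∈p∩q⁻ (∁ p) q a)) (proj₁ (x∈p∩q⁻ p q b))

-- Otherwise `q ⊆ p`, strictly because of `x`, against the cardinalities.
exchange-exists : ∣ p ∣ ≤ ∣ q ∣ → x ∈ p → x ∉ q → ∃ λ y → y ∈ q × y ∉ p
exchange-exists {p = p} {q} le x∈p x∉q with nonempty? (q ∩ ∁ p)
... | yes (y , h) = y , proj₁ (x∈p∩q⁻ q (∁ p) h) , x∈∁p⇒x∉p (proj₂ (x∈p∩q⁻ q (∁ p) h))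
... | no  empty   = contradiction le (ℕ.<⇒≱ (p⊂q⇒∣p∣<∣q∣ (q⊆p , _ , x∈p , x∉q)))
  where
  q⊆p : q ⊆ p
  q⊆p {y} y∈q with y ∈? p
  ... | yes y∈p = y∈p
  ... | no  y∉p = contradiction (y , x∈p∩q⁺ (y∈q , x∉p⇒x∈∁p y∉p)) empty

∉⇒lookup : x ∉ p → Vec.lookup p x ≡ false
∉⇒lookup {x = x} {p} x∉p with Vec.lookup p x in eq
... | true  = contradiction (lookup⇒[]= x p eq) x∉p
... | false = refl

lookup⇒∉ : Vec.lookup p x ≡ false → x ∉ p
lookup⇒∉ eq x∈p with () ← trans (sym eq) ([]=⇒lookup x∈p)

x∈⋃⁺ : ∀ {ps : List (Subset n)} → p ∈ₗ ps → x ∈ p → x ∈ ⋃ ps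
x∈⋃⁺ {ps = q ∷ ps} (here refl) x∈p = p⊆p∪q (⋃ ps) x∈p
x∈⋃⁺ {ps = q ∷ ps} (there h) x∈p = q⊆p∪q q (⋃ ps) (x∈⋃⁺ h x∈p)

x∈⋃⁻ : ∀ (ps : List (Subset n)) → x ∈ ⋃ ps → ∃ λ p → p ∈ₗ ps × x ∈ p
x∈⋃⁻ []       h = contradiction h ∉⊥
x∈⋃⁻ (q ∷ ps) h with x∈p∪q⁻ q (⋃ ps) h
... | inj₁ x∈q = q , here refl , x∈q
... | inj₂ x∈ps with p , p∈ps , x∈p ← x∈⋃⁻ ps x∈ps = p , there p∈ps , x∈p

-- Sums over subsets and minimisation over finite lists.

module SubsetSum {c ℓ} (M : CommutativeMonoid c ℓ) where
  open CommutativeMonoid M hiding (sym; refl; trans)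
  open CommutativeSemigroupProperties commutativeSemigroup using (x∙yz≈y∙xz)
  private module M = CommutativeMonoid M

  -- Two monoids occur below: in `ℕ` the sum counts finite coordinates, in the reals it adds negated
  -- coordinates.
  ∑ : (Fin n → Carrier) → Subset n → Carrier
  ∑ f []      = ε
  ∑ f (s ∷ p) = (if s then f zero else ε) ∙ ∑ (f ∘ suc) p

  ∑-insert : ∀ (f : Fin n → Carrier) {x p} → x ∉ p → ∑ f (p ∪ ⁅ x ⁆) ≈ f x ∙ ∑ f p
  ∑-insert f {zero} {inside ∷ p} x∉p = contradiction here x∉p
  ∑-insert f {zero} {outside ∷ p} x∉p rewrite ∪-identityʳ p =
    ∙-cong M.refl (M.sym (identityˡ _))
  ∑-insert f {suc x} {s ∷ p} x∉p rewrite ∨-identityʳ s =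
    M.trans (∙-cong M.refl (∑-insert (f ∘ suc) (x∉p ∘ there))) (x∙yz≈y∙xz _ _ _)

subsets : ∀ n → List (Subset n)
subsets zero    = [] ∷ []
subsets (suc n) = List.map (inside ∷_) (subsets n) ++ List.map (outside ∷_) (subsets n)

∈-subsets : ∀ (p : Subset n) → p ∈ₗ subsets n
∈-subsets []            = here refl
∈-subsets (inside ∷ p)  = ∈-++⁺ˡ (∈-map⁺ _ (∈-subsets p))
∈-subsets (outside ∷ p) = ∈-++⁺ʳ _ (∈-map⁺ _ (∈-subsets p))

module _ {b ℓ₁ ℓ₂} (O : TotalOrder b ℓ₁ ℓ₂) where
  open TotalOrder O using (Carrier) renaming (_≤_ to _≼_)
  open Extrema O

  -- The seed `x₀` of `argmin` satisfies `P`, and so does every entry of the filtered list; hence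
  -- the result does too.
  minimiser : ∀ {a p} {A : Set a} (f : A → Carrier) {P : A → Set p} → Decidable P →
              (xs : List A) → (∀ x → x ∈ₗ xs) → ∃ P →
              ∃ λ x → P x × (∀ y → P y → f x ≼ f y)
  minimiser f P? xs complete (x₀ , px₀) =
    argmin f x₀ (filter P? xs) ,
    argmin-all f px₀ (all-filter P? xs) ,
    λ y py → lookup (f[argmin]≤f[xs] x₀ (filter P? xs)) (∈-filter⁺ P? (complete y) py)

-- Tropical arithmetic and tropical hypersurfaces.

module Theory (R : RealField) where
  open Tropical R
  open RealField R renaming (Carrier to ℝ; _≤_ to _≤ᴿ_)
  private module ≤ᴿ = IsDecTotalOrder isDecTotalOrder

  realRing : CommutativeRing _ _
  realRing = record { isCommutativeRing = isCommutativeRing }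

  open RingSolver (fromCommutativeRing realRing) ≤ᴿ._≟_
    using (solve; _:=_; _:+_)

  open CommutativeRing realRing using (+-assoc; +-comm; +-identityʳ; -‿inverseˡ; -‿inverseʳ)

  +-monoʳ-≤ : ∀ {x y} z → x ≤ᴿ y → z + x ≤ᴿ z + y
  +-monoʳ-≤ {x} {y} z x≤y = subst₂ _≤ᴿ_ (+-comm x z) (+-comm y z) (+-monoˡ-≤ z x≤y)

  +-mono-≤ : ∀ {a b c d} → a ≤ᴿ b → c ≤ᴿ d → a + c ≤ᴿ b + d
  +-mono-≤ {b = b} {c} a≤b c≤d = ≤ᴿ.trans (+-monoˡ-≤ c a≤b) (+-monoʳ-≤ b c≤d)

  ≤T-refl : ∀ {t} → t ≤T t
  ≤T-refl {fin x} = fin≤fin ≤ᴿ.refl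
  ≤T-refl {∞}     = ∞ ≤∞

  ≤T-reflexive : ∀ {s t} → s ≡ t → s ≤T t
  ≤T-reflexive refl = ≤T-refl

  ≤T-trans : ∀ {s t u} → s ≤T t → t ≤T u → s ≤T u
  ≤T-trans (fin≤fin a) (fin≤fin b) = fin≤fin (≤ᴿ.trans a b)
  ≤T-trans {s} _       (_ ≤∞)      = s ≤∞

  ≤T-antisym : ∀ {s t} → s ≤T t → t ≤T s → s ≡ t
  ≤T-antisym (fin≤fin a) (fin≤fin b) = cong fin (≤ᴿ.antisym a b)
  ≤T-antisym (.∞ ≤∞)     (.∞ ≤∞)     = refl

  ≤T-total : ∀ s t → s ≤T t ⊎ t ≤T s
  ≤T-total s       ∞       = inj₁ (s ≤∞)
  ≤T-total ∞       (fin x) = inj₂ (fin x ≤∞)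
  ≤T-total (fin x) (fin y) with ≤ᴿ.total x y
  ... | inj₁ x≤y = inj₁ (fin≤fin x≤y)
  ... | inj₂ y≤x = inj₂ (fin≤fin y≤x)

  ≤T-totalOrder : TotalOrder _ _ _
  ≤T-totalOrder = record
    { Carrier = 𝕋 ; _≈_ = _≡_ ; _≤_ = _≤T_
    ; isTotalOrder = record
      { isPartialOrder = record
        { isPreorder = record
          { isEquivalence = isEquivalence ; reflexive = ≤T-reflexive ; trans = ≤T-trans }
        ; antisym = ≤T-antisym }
      ; total = ≤T-total } }

  ≡∞? : ∀ t → Dec (t ≡ ∞)
  ≡∞? (fin x) = no λ ()
  ≡∞? ∞       = yes refl

  ≤T-finite : ∀ {s t} → s ≤T t → t ≢ ∞ → s ≢ ∞
  ≤T-finite (fin≤fin _) _   = λ ()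
  ≤T-finite (_ ≤∞)      t≢∞ = contradiction refl t≢∞

  ⊙-comm : ∀ s t → s ⊙ t ≡ t ⊙ s
  ⊙-comm (fin x) (fin y) = cong fin (+-comm x y)
  ⊙-comm (fin x) ∞       = refl
  ⊙-comm ∞       (fin y) = refl
  ⊙-comm ∞       ∞       = refl

  ⊙-zeroʳ : ∀ t → t ⊙ ∞ ≡ ∞
  ⊙-zeroʳ (fin x) = refl
  ⊙-zeroʳ ∞       = refl

  ⊙-finiteˡ : ∀ {s t} → s ⊙ t ≢ ∞ → s ≢ ∞
  ⊙-finiteˡ h refl = h refl

  ⊙-finiteʳ : ∀ {s t} → s ⊙ t ≢ ∞ → t ≢ ∞
  ⊙-finiteʳ {s} h refl = h (⊙-zeroʳ s)

  ⊙-finite : ∀ {s t} → s ≢ ∞ → t ≢ ∞ → s ⊙ t ≢ ∞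
  ⊙-finite {∞}             s≢∞ _   = contradiction refl s≢∞
  ⊙-finite {fin x} {∞}     _   t≢∞ = contradiction refl t≢∞
  ⊙-finite {fin x} {fin y} _   _   = λ ()

  -- A form of `InV` that names no minimum: every finite term, minimal or not, is weakly undercut by
  -- another one. Exchange axioms produce inequalities of exactly this shape.
  Balanced : ∀ {m} → (Fin m → 𝕋) → Set
  Balanced t = ∀ a → t a ≢ ∞ → ∃ λ b → b ≢ a × t b ≤T t a

  InV⇒Balanced : ∀ {m} {t : Fin m → 𝕋} → InV t → Balanced t
  InV⇒Balanced (inj₁ all∞) a ta≢∞ = contradiction (all∞ a) ta≢∞
  InV⇒Balanced {t = t} (inj₂ (b , c , b≢c , tb≡tc , min)) a _ with b ≟ a
  ... | no  b≢a  = b , b≢a , min a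
  ... | yes refl = c , b≢c ∘ sym , subst (_≤T t a) tb≡tc (min a)

  -- At a minimising index, balancing yields a second index whose term is at most, hence equal to,
  -- the minimum. An infinite minimum falls under the first alternative of `InV`.
  Balanced⇒InV : ∀ {m} {t : Fin m → 𝕋} → Balanced t → InV t
  Balanced⇒InV {zero}      _   = inj₁ λ ()
  Balanced⇒InV {suc m} {t} bal
    with a , _ , min ← minimiser ≤T-totalOrder t (λ _ → yes tt) (allFin _) ∈-allFin (zero , tt)
    with ≡∞? (t a)
  ... | yes ta≡∞ = inj₁ λ c → ≤T-antisym (t c ≤∞) (subst (_≤T t c) ta≡∞ (min c tt))
  ... | no  ta≢∞ with b , b≢a , tb≤ta ← bal a ta≢∞ =
    inj₂ (a , b , b≢a ∘ sym , ≤T-antisym (min b tt) tb≤ta , λ c → min c tt)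

  Balanced-cong : ∀ {m} {t u : Fin m → 𝕋} → (∀ a → t a ≡ u a) → Balanced t → Balanced u
  Balanced-cong t≗u bal a ua≢∞ with b , b≢a , le ← bal a (ua≢∞ ∘ trans (sym (t≗u a))) =
    b , b≢a , subst₂ _≤T_ (t≗u b) (t≗u a) le

  -- The index set is kept as `P` instead of padding by `∞`. Both forms agree because a term that
  -- undercuts a finite term is itself finite, so it is no padding.
  BalancedOn : ∀ {m} → (Fin m → Set) → (Fin m → 𝕋) → Set
  BalancedOn P t = ∀ a → P a → t a ≢ ∞ → ∃ λ b → b ≢ a × P b × t b ≤T t a

  restrict : ∀ {m} → (Fin m → Bool) → (Fin m → 𝕋) → Fin m → 𝕋
  restrict c t a = if c a then t a else ∞

  module _ {m} {c : Fin m → Bool} {P : Fin m → Set} {t : Fin m → 𝕋}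
           (sound : ∀ {a} → c a ≡ true → P a) (complete : ∀ {a} → P a → c a ≡ true) where

    restrict-finite : ∀ {a} → restrict c t a ≢ ∞ → P a
    restrict-finite {a} h with c a in eq
    ... | true  = sound eq
    ... | false = contradiction refl h

    restrict-≡ : ∀ {a} → P a → restrict c t a ≡ t a
    restrict-≡ pa rewrite complete pa = refl

    InV⇒BalancedOn : InV (restrict c t) → BalancedOn P t
    InV⇒BalancedOn inV a pa ta≢∞
      with b , b≢a , le ← InV⇒Balanced inV a (ta≢∞ ∘ trans (sym (restrict-≡ pa))) =
      b , b≢a , pb , subst₂ _≤T_ (restrict-≡ pb) (restrict-≡ pa) le
      where pb = restrict-finite (≤T-finite le (ta≢∞ ∘ trans (sym (restrict-≡ pa))))

    BalancedOn⇒InV : BalancedOn P t → InV (restrict c t)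
    BalancedOn⇒InV bal = Balanced⇒InV λ a h →
      let pa = restrict-finite h
          b , b≢a , pb , le = bal a pa (h ∘ trans (restrict-≡ pa))
      in b , b≢a , subst₂ _≤T_ (sym (restrict-≡ pb)) (sym (restrict-≡ pa)) le

  -- Incidence relations, vectors, projections and quotients.

  private
    variable
      r s k : ℕ
      S : Subset n
      μ ν δ : Val n

  Incidence : ℕ → ℕ → Subset n → Val n → Val n → Set
  Incidence r s S μ ν = ∀ I J → suc ∣ I ∣ ≡ r → ∣ J ∣ ≡ suc s →
    BalancedOn (λ j → j ∈ J × j ∉ I × j ∉ S) (λ j → μ (I ∪ ⁅ j ⁆) ⊙ ν (J - j))

  private
    ∈∖-sound : ∀ {I J : Subset n} {j} →
      Vec.lookup J j ∧ not (Vec.lookup I j ∨ Vec.lookup S j) ≡ true → j ∈ J × j ∉ I × j ∉ S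
    ∈∖-sound {S = S} {I} {J} {j} eq
      with Vec.lookup J j in eJ | Vec.lookup I j in eI | Vec.lookup S j in eS
    ... | true | false | false = lookup⇒[]= j J eJ , lookup⇒∉ eI , lookup⇒∉ eS

    ∈∖-complete : ∀ {I J : Subset n} {j} → j ∈ J × j ∉ I × j ∉ S →
      Vec.lookup J j ∧ not (Vec.lookup I j ∨ Vec.lookup S j) ≡ true
    ∈∖-complete (j∈J , j∉I , j∉S) rewrite []=⇒lookup j∈J | ∉⇒lookup j∉I | ∉⇒lookup j∉S = refl

  plucker⇒incidence : ∀ (S : Subset n) μ ν → PluckerHolds r s S μ ν → Incidence r s S μ ν
  plucker⇒incidence S μ ν h I J ∣I∣ ∣J∣ =
    InV⇒BalancedOn (∈∖-sound {S = S} {I} {J}) ∈∖-complete (h I J ∣I∣ ∣J∣)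

  incidence⇒plucker : ∀ (S : Subset n) μ ν → Incidence r s S μ ν → PluckerHolds r s S μ ν
  incidence⇒plucker S μ ν h I J ∣I∣ ∣J∣ =
    BalancedOn⇒InV (∈∖-sound {S = S} {I} {J}) ∈∖-complete (h I J ∣I∣ ∣J∣)

  record IsVector (r : ℕ) (μ : Val n) (x : Fin n → 𝕋) : Set where
    constructor vector
    field balanced : ∀ K → ∣ K ∣ ≡ suc r → BalancedOn (_∈ K) (λ i → μ (K - i) ⊙ x i)

  open IsVector

  private
    circuit-term : ∀ (μ : Val n) (K : Subset n) (x : Fin n → 𝕋) i →
      circuit μ K i ⊙ x i ≡ restrict (Vec.lookup K) (λ i → μ (K - i) ⊙ x i) i
    circuit-term μ K x i with Vec.lookup K i
    ... | true  = refl
    ... | false = refl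

    circuit-∈ : ∀ (μ : Val n) {K : Subset n} {i} → i ∈ K → circuit μ K i ≡ μ (K - i)
    circuit-∈ μ i∈K rewrite []=⇒lookup i∈K = refl

  tropLin⇒vector : ∀ (μ : Val n) x → TropLin r μ x → IsVector r μ x
  tropLin⇒vector μ x (_ , h) .balanced K ∣K∣ a a∈K fa =
    InV⇒BalancedOn (lookup⇒[]= _ K) []=⇒lookup
      (Balanced⇒InV (Balanced-cong (circuit-term μ K x) (InV⇒Balanced
        -- The finite term at `a` shows that the circuit on `K` is nonzero, as `TropLin` demands.
        (h K ∣K∣ (a , λ eq → ⊙-finiteˡ fa (trans (sym (circuit-∈ μ a∈K)) eq))))))
      a a∈K fa

  vector⇒tropLin : ∀ {x} → NonZeroPt x → IsVector r μ x → TropLin r μ x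
  vector⇒tropLin {μ = μ} {x} nz h = nz , λ K ∣K∣ _ →
    Balanced⇒InV (Balanced-cong (sym ∘ circuit-term μ K x) (InV⇒Balanced
      (BalancedOn⇒InV (lookup⇒[]= _ K) []=⇒lookup (h .balanced K ∣K∣))))

  IsVector-cong : ∀ {x y} → (∀ i → x i ≡ y i) → IsVector r μ x → IsVector r μ y
  IsVector-cong {μ = μ} {x} {y} x≗y h .balanced K ∣K∣ a a∈K fa
    with b , b≢a , b∈K , le ← h .balanced K ∣K∣ a a∈K
           (fa ∘ trans (sym (cong (μ (K - a) ⊙_) (x≗y a)))) =
    b , b≢a , b∈K , subst₂ _≤T_ (cong (μ (K - b) ⊙_) (x≗y b)) (cong (μ (K - a) ⊙_) (x≗y a)) le

  prTrop-∉ : ∀ (S : Subset n) x {i} → i ∉ S → prTrop S x i ≡ x i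
  prTrop-∉ S x i∉S rewrite ∉⇒lookup i∉S = refl

  prTrop-∈ : ∀ (S : Subset n) x {i} → i ∈ S → prTrop S x i ≡ ∞
  prTrop-∈ S x i∈S rewrite []=⇒lookup i∈S = refl

  prTrop-finite : ∀ (S : Subset n) x {i} → prTrop S x i ≢ ∞ → i ∉ S
  prTrop-finite S x h i∈S = h (prTrop-∈ S x i∈S)

  prTrop-∪ : ∀ (S T : Subset n) x i → prTrop (S ∪ T) x i ≡ prTrop T (prTrop S x) i
  prTrop-∪ S T x i with i ∈? S | i ∈? T
  ... | yes i∈S | yes i∈T = trans (prTrop-∈ _ x (p⊆p∪q T i∈S)) (sym (prTrop-∈ T (prTrop S x) i∈T))
  ... | yes i∈S | no  i∉T = trans (prTrop-∈ _ x (p⊆p∪q T i∈S))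
                              (sym (trans (prTrop-∉ T (prTrop S x) i∉T) (prTrop-∈ S x i∈S)))
  ... | no  i∉S | yes i∈T = trans (prTrop-∈ _ x (q⊆p∪q S T i∈T)) (sym (prTrop-∈ T (prTrop S x) i∈T))
  ... | no  i∉S | no  i∉T = trans (prTrop-∉ _ x ([ i∉S , i∉T ]′ ∘ x∈p∪q⁻ S T))
                              (sym (trans (prTrop-∉ T (prTrop S x) i∉T) (prTrop-∉ S x i∉S)))

  ProjectsInto : ℕ → ℕ → Subset n → Val n → Val n → Set
  ProjectsInto r s S μ ν = ∀ x → IsVector r μ x → IsVector s ν (prTrop S x)

  -- Balancing only concerns finite terms, and the index `a` of such a term lies outside `S` and
  -- witnesses that both `x` and its projection are points of projective space.
  projTrop⇒projectsInto : (∀ y → ProjTrop S (TropLin r μ) y → TropLin s ν y) →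
                          ProjectsInto r s S μ ν
  projTrop⇒projectsInto {S = S} {ν = ν} h x vx .balanced K ∣K∣ a a∈K fa =
    tropLin⇒vector ν (prTrop S x) (h (prTrop S x)
      ((a , ya≢∞) , x , vector⇒tropLin (a , ya≢∞ ∘ trans (prTrop-∉ S x a∉S)) vx , λ _ → refl))
      .balanced K ∣K∣ a a∈K fa
    where
    ya≢∞ = ⊙-finiteʳ {ν (K - a)} fa
    a∉S  = prTrop-finite S x ya≢∞

  projectsInto⇒projTrop : ∀ (μ : Val n) → ProjectsInto r s S μ ν →
                          ∀ y → ProjTrop S (TropLin r μ) y → TropLin s ν y
  projectsInto⇒projTrop μ h y (nz , x , tx , eq) =
    vector⇒tropLin nz (IsVector-cong eq (h x (tropLin⇒vector μ x tx)))

  Quotient-intro : ∀ (μ ν : Val n) → r ℕ.≤ s →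
    (∀ I J i → ∣ I ∣ ≡ r → ∣ J ∣ ≡ s → i ∈ I → i ∉ J → μ I ⊙ ν J ≢ ∞ →
      ∃ λ j → j ∈ J × j ∉ I × (μ ((I - i) ∪ ⁅ j ⁆) ⊙ ν ((J - j) ∪ ⁅ i ⁆) ≤T μ I ⊙ ν J)) →
    Quotient r s μ ν
  Quotient-intro μ ν r≤s h I J i ∣I∣ ∣J∣ i∈I i∉J with ≡∞? (μ I ⊙ ν J)
  ... | no  finite = h I J i ∣I∣ ∣J∣ i∈I i∉J finite
  -- An infinite right-hand side is met by any element of `J` outside `I`; one exists because
  -- `r ≤ s`.
  ... | yes eq
    with j , j∈J , j∉I ← exchange-exists (subst₂ ℕ._≤_ (sym ∣I∣) (sym ∣J∣) r≤s) i∈I i∉J =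
    j , j∈J , j∉I , subst (μ _ ⊙ ν _ ≤T_) (sym eq) (_ ≤∞)

  Quotient-congˡ : ∀ (ν : Val n) → (∀ I → ∣ I ∣ ≡ r → μ I ≡ δ I) →
                   Quotient r s μ ν → Quotient r s δ ν
  Quotient-congˡ ν μ≗δ h I J i ∣I∣ ∣J∣ i∈I i∉J
    with j , j∈J , j∉I , le ← h I J i ∣I∣ ∣J∣ i∈I i∉J =
    j , j∈J , j∉I , subst₂ _≤T_
      (cong (_⊙ ν ((J - j) ∪ ⁅ i ⁆)) (μ≗δ _ (trans (∣exchange∣ i∈I j∉I) ∣I∣)))
      (cong (_⊙ ν J) (μ≗δ I ∣I∣)) le

  -- Exchanging a minimal term a out of I ∪ a and into J - a produces a second minimal term.
  quotient⇒incidence : ∀ (μ ν : Val n) → Quotient r s μ ν → Incidence r s ⊥ μ ν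
  quotient⇒incidence μ ν h I J ∣I∣ ∣J∣ a (a∈J , a∉I , _) _
    with b , b∈J-a , b∉I∪a , le ← h (I ∪ ⁅ a ⁆) (J - a) a (trans (∣insert∣ a∉I) ∣I∣)
           (ℕ.suc-injective (trans (∣remove∣ a∈J) ∣J∣)) x∈p∪⁅x⁆ (x∉p-x {p = J}) =
    b , b≢a , (x∈p-y⇒x∈p b∈J-a , b∉I∪a ∘ p⊆p∪q ⁅ a ⁆ , ∉⊥) ,
    subst (_≤T _) (cong₂ _⊙_ (cong (λ X → μ (X ∪ ⁅ b ⁆)) (insert-remove a∉I)) (cong ν eqJ)) le
    where
    b≢a = x∈p-y⇒x≢y b∈J-a
    eqJ : ((J - a) - b) ∪ ⁅ a ⁆ ≡ J - b
    eqJ = trans (cong (_∪ ⁅ a ⁆) (p─x─y≡p─y─x J a b))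
                (remove-insert (x∈p∧x≢y⇒x∈p-y a∈J (b≢a ∘ sym)))

  -- Deletion of `S`.

  HasRank-≤ : ∀ (μ : Val n) S → HasRank r μ S k → k ℕ.≤ r
  HasRank-≤ μ S ((B , (∣B∣ , _) , ∣S∩B∣) , _) =
    subst₂ ℕ._≤_ ∣S∩B∣ ∣B∣ (∣p∩q∣≤∣q∣ S B)

  module Deletion {r k} (μ δ : Val n) (S : Subset n) (isMuS : IsMuS r μ S k δ) where
    private
      I₀ : Subset n
      I₀ = proj₁ (proj₂ isMuS)
      I₀⊆S : I₀ ⊆ S
      I₀⊆S = proj₁ (proj₂ (proj₂ isMuS))
      k≤r : k ℕ.≤ r
      k≤r = HasRank-≤ μ (∁ S) (proj₁ isMuS)

      δ-avoid : ∀ {B} → Empty (B ∩ S) → δ B ≡ μ (B ∪ I₀)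
      δ-avoid = proj₁ (proj₂ (proj₂ (proj₂ (proj₂ (proj₂ isMuS))))) _

      δ-finite⇒avoid : ∀ {B x} → δ B ≢ ∞ → x ∈ B → x ∉ S
      δ-finite⇒avoid δB≢∞ x∈B x∈S =
        δB≢∞ (proj₂ (proj₂ (proj₂ (proj₂ (proj₂ (proj₂ isMuS))))) _ (_ , x∈p∩q⁺ (x∈B , x∈S)))

      avoid : ∀ {B} → (∀ {x} → x ∈ B → x ∉ S) → Empty (B ∩ S)
      avoid {B} h (x , x∈) = h (proj₁ (x∈p∩q⁻ B S x∈)) (proj₂ (x∈p∩q⁻ B S x∈))

      ∣∪I₀∣ : ∀ {B} → (∀ {x} → x ∈ B → x ∉ S) → ∣ B ∪ I₀ ∣ ≡ ∣ B ∣ ℕ.+ (r ℕ.∸ k)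
      ∣∪I₀∣ {B} h = trans (∣disjoint-∪∣ (λ x∈B → h x∈B ∘ I₀⊆S))
                          (cong (∣ B ∣ ℕ.+_) (proj₁ (proj₂ (proj₂ (proj₂ isMuS)))))

    -- Let `δ I` be finite, so that `I` avoids `S`. The relation for `(I - i) ∪ I₀` and `J ∪ ⁅ i ⁆`
    -- has the term `δ I ⊙ ν J` at `i`, and its other terms are the exchanged products. Balancing at
    -- `i` is therefore the exchange property.
    incidence⇒quotient : ∀ ν → r ℕ.≤ s → Incidence r s S μ ν → Quotient k s δ ν
    incidence⇒quotient ν r≤s inc = Quotient-intro δ ν (ℕ.≤-trans k≤r r≤s) go
      where
      go : ∀ I J i → ∣ I ∣ ≡ k → ∣ J ∣ ≡ _ → i ∈ I → i ∉ J → δ I ⊙ ν J ≢ ∞ →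
        ∃ λ j → j ∈ J × j ∉ I × (δ ((I - i) ∪ ⁅ j ⁆) ⊙ ν ((J - j) ∪ ⁅ i ⁆) ≤T δ I ⊙ ν J)
      go I J i ∣I∣ ∣J∣ i∈I i∉J finite =
        let b , b≢i , (b∈J∪i , b∉A , b∉S) , le =
              inc A (J ∪ ⁅ i ⁆) ∣A∣ (trans (∣insert∣ i∉J) (cong suc ∣J∣)) i
                (x∈p∪⁅x⁆ , i∉A , I∩S i∈I) (finite ∘ trans (sym term-i))
            b∈J = x∈p∪⁅y⁆∧x≢y⇒x∈p b∈J∪i b≢i
            b∉I = λ b∈I → b∉A (p⊆p∪q I₀ (x∈p∧x≢y⇒x∈p-y b∈I b≢i))
        in b , b∈J , b∉I , subst₂ _≤T_ (term b≢i b∉S) term-i le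
        where
        I∩S : ∀ {x} → x ∈ I → x ∉ S
        I∩S = δ-finite⇒avoid (⊙-finiteˡ finite)
        A : Subset n
        A = (I - i) ∪ I₀
        i∉A : i ∉ A
        i∉A h with x∈p∪q⁻ (I - i) I₀ h
        ... | inj₁ i∈  = x∉p-x {p = I} i∈
        ... | inj₂ i∈₀ = I∩S i∈I (I₀⊆S i∈₀)
        A∪i : A ∪ ⁅ i ⁆ ≡ I ∪ I₀
        A∪i = trans (∪-swapʳ (I - i) I₀ ⁅ i ⁆) (cong (_∪ I₀) (remove-insert i∈I))
        ∣A∣ : suc ∣ A ∣ ≡ r
        ∣A∣ = trans (sym (∣insert∣ i∉A)) (trans (cong ∣_∣ A∪i)
          (trans (∣∪I₀∣ I∩S) (trans (cong (ℕ._+ (r ℕ.∸ k)) ∣I∣) (ℕ.m+[n∸m]≡n k≤r))))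
        term-i : μ (A ∪ ⁅ i ⁆) ⊙ ν ((J ∪ ⁅ i ⁆) - i) ≡ δ I ⊙ ν J
        term-i = cong₂ _⊙_ (trans (cong μ A∪i) (sym (δ-avoid (avoid I∩S))))
                           (cong ν (insert-remove i∉J))
        term : ∀ {b} → b ≢ i → b ∉ S →
          μ (A ∪ ⁅ b ⁆) ⊙ ν ((J ∪ ⁅ i ⁆) - b) ≡ δ ((I - i) ∪ ⁅ b ⁆) ⊙ ν ((J - b) ∪ ⁅ i ⁆)
        term {b} b≢i b∉S = cong₂ _⊙_
          (trans (cong μ (∪-swapʳ (I - i) I₀ ⁅ b ⁆)) (sym (δ-avoid (avoid av))))
          (cong ν (∪-remove J ⁅ i ⁆ (b≢i ∘ x∈⁅y⁆⇒x≡y i)))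
          where
          av : ∀ {x} → x ∈ (I - i) ∪ ⁅ b ⁆ → x ∉ S
          av h with x∈p∪q⁻ (I - i) ⁅ b ⁆ h
          ... | inj₁ x∈ = I∩S (x∈p-y⇒x∈p x∈)
          ... | inj₂ x∈ with refl ← x∈⁅y⁆⇒x≡y b x∈ = b∉S

    -- The circuit of δ on K is the circuit of μ on K ∪ I₀, whose entries on I₀ vanish
    -- because ∁ S has rank k only.
    projectsInto : ProjectsInto r k S μ δ
    projectsInto x vx .balanced K ∣K∣ a a∈K fa =
      let b , b≢a , b∈K∪I₀ , le = vx .balanced (K ∪ I₀) ∣K∪I₀∣ a (p⊆p∪q I₀ a∈K) (fa ∘ trans (sym (term a∈K)))
          b∈K = ∈K b∈K∪I₀ (⊙-finiteˡ (≤T-finite le (fa ∘ trans (sym (term a∈K)))))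
      in b , b≢a , b∈K , subst₂ _≤T_ (term b∈K) (term a∈K) le
      where
      -- `a` avoids `S` because the projected coordinate is finite there, the rest of `K` because
      -- `δ (K - a)` is finite.
      K∩S : ∀ {x} → x ∈ K → x ∉ S
      K∩S {z} z∈K with z ≟ a
      ... | yes refl = prTrop-finite S x (⊙-finiteʳ {δ (K - a)} fa)
      ... | no  z≢a  = δ-finite⇒avoid (⊙-finiteˡ fa) (x∈p∧x≢y⇒x∈p-y z∈K z≢a)
      ∣K∪I₀∣ : ∣ K ∪ I₀ ∣ ≡ suc r
      ∣K∪I₀∣ = trans (∣∪I₀∣ K∩S) (trans (cong (ℕ._+ (r ℕ.∸ k)) ∣K∣) (cong suc (ℕ.m+[n∸m]≡n k≤r)))
      term : ∀ {b} → b ∈ K → μ ((K ∪ I₀) - b) ⊙ x b ≡ δ (K - b) ⊙ prTrop S x b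
      term b∈K = cong₂ _⊙_
        (trans (cong μ (∪-remove K I₀ (K∩S b∈K ∘ I₀⊆S))) (sym (δ-avoid (avoid (K∩S ∘ x∈p-y⇒x∈p)))))
        (sym (prTrop-∉ S x (K∩S b∈K)))
      ∈K : ∀ {b} → b ∈ K ∪ I₀ → μ ((K ∪ I₀) - b) ≢ ∞ → b ∈ K
      ∈K {b} b∈ μ≢∞ with b ∈? K
      ... | yes b∈K = b∈K
      ... | no  b∉K = contradiction (ℕ.≤-trans (ℕ.≤-trans (ℕ.≤-reflexive (sym ∣K∣)) (p⊆q⇒∣p∣≤∣q∣ K⊆))
          (proj₂ (proj₁ isMuS) _ (ℕ.suc-injective (trans (∣remove∣ b∈) ∣K∪I₀∣) , μ≢∞)))
          (ℕ.<⇒≱ ℕ.≤-refl)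
        where
        K⊆ : K ⊆ ∁ S ∩ ((K ∪ I₀) - b)
        K⊆ z∈K = x∈p∩q⁺ (x∉p⇒x∈∁p (K∩S z∈K) ,
                  x∈p∧x≢y⇒x∈p-y (p⊆p∪q I₀ z∈K) λ { refl → b∉K z∈K })

  -- Take a basis `B₀` with `∣ S ∩ B₀ ∣` least. Bases have equal size, so `∣ ∁ S ∩ B₀ ∣` is largest
  -- and equals the rank of `∁ S`; thus `S ∩ B₀` is an admissible choice of `I`. The basis
  -- `∁ S ∩ B₀` of the deletion is returned as a starting point for the optimisation below.
  deletion-exists : ∀ (μ : Val n) (S : Subset n) → (∃ λ I → ∣ I ∣ ≡ r × μ I ≢ ∞) →
    ∃ λ k → ∃ λ δ → IsMuS r μ S k δ × ∃ λ B → ∣ B ∣ ≡ k × δ B ≢ ∞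
  deletion-exists {n} {r} μ S basis =
    ℓ , μₛ , ((rank , bound) , S ∩ B₀ , p∩q⊆p S B₀ , ∣I₀∣ ,
      ((B₀ , (∣B₀∣ , μB₀) , ∣full∣) , λ B (∣B∣ , _) → ℕ.≤-trans (∣p∩q∣≤∣q∣ (∁ S ∪ (S ∩ B₀)) B) (ℕ.≤-reflexive ∣B∣)) ,
      μₛ-avoid , μₛ-meet) ,
    ∁ S ∩ B₀ , refl , λ eq → μB₀ (trans (sym (cong μ (∩-∁-partition S B₀)))
      (trans (sym (μₛ-avoid (∁ S ∩ B₀) disjoint)) eq))
    where
    min : ∃ λ B → (∣ B ∣ ≡ r × μ B ≢ ∞) × (∀ B′ → ∣ B′ ∣ ≡ r × μ B′ ≢ ∞ → ∣ S ∩ B ∣ ℕ.≤ ∣ S ∩ B′ ∣)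
    min = minimiser ℕ.≤-totalOrder (λ B → ∣ S ∩ B ∣) (λ B → (∣ B ∣ ℕ.≟ r) ×-dec ¬? (≡∞? (μ B)))
            (subsets n) ∈-subsets basis
    B₀ : Subset n
    B₀ = proj₁ min
    ∣B₀∣ : ∣ B₀ ∣ ≡ r
    ∣B₀∣ = proj₁ (proj₁ (proj₂ min))
    μB₀ : μ B₀ ≢ ∞
    μB₀ = proj₂ (proj₁ (proj₂ min))
    ℓ : ℕ
    ℓ = ∣ ∁ S ∩ B₀ ∣
    rank : ∃ λ B → Basis r μ B × ∣ ∁ S ∩ B ∣ ≡ ℓ
    rank = B₀ , (∣B₀∣ , μB₀) , refl
    bound : ∀ B → Basis r μ B → ∣ ∁ S ∩ B ∣ ℕ.≤ ℓ
    bound B basis@(∣B∣ , _) = ℕ.+-cancelʳ-≤ ∣ S ∩ B₀ ∣ _ _ (begin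
      ∣ ∁ S ∩ B ∣ ℕ.+ ∣ S ∩ B₀ ∣  ≤⟨ ℕ.+-monoʳ-≤ _ (proj₂ (proj₂ min) B basis) ⟩
      ∣ ∁ S ∩ B ∣ ℕ.+ ∣ S ∩ B ∣   ≡⟨ ∣∁p∩q∣+∣p∩q∣ S B ⟩
      ∣ B ∣                       ≡⟨ trans ∣B∣ (sym ∣B₀∣) ⟩
      ∣ B₀ ∣                      ≡⟨ ∣∁p∩q∣+∣p∩q∣ S B₀ ⟨
      ℓ ℕ.+ ∣ S ∩ B₀ ∣            ∎)
      where open ℕ.≤-Reasoning
    ∣I₀∣ : ∣ S ∩ B₀ ∣ ≡ r ℕ.∸ ℓ
    ∣I₀∣ = sym (trans (cong (ℕ._∸ ℓ) (trans (sym ∣B₀∣) (sym (∣∁p∩q∣+∣p∩q∣ S B₀)))) (ℕ.m+n∸m≡n ℓ _))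
    ∣full∣ : ∣ (∁ S ∪ (S ∩ B₀)) ∩ B₀ ∣ ≡ r
    ∣full∣ = trans (cong ∣_∣ (⊆-antisym (p∩q⊆q _ B₀) ⊇)) ∣B₀∣
      where
      ⊇ : B₀ ⊆ (∁ S ∪ (S ∩ B₀)) ∩ B₀
      ⊇ {x} x∈B₀ with x ∈? S
      ... | yes x∈S = x∈p∩q⁺ (q⊆p∪q (∁ S) _ (x∈p∩q⁺ (x∈S , x∈B₀)) , x∈B₀)
      ... | no  x∉S = x∈p∩q⁺ (p⊆p∪q _ (x∉p⇒x∈∁p x∉S) , x∈B₀)
    μₛ : Val n
    μₛ B with nonempty? (B ∩ S)
    ... | yes _ = ∞
    ... | no  _ = μ (B ∪ (S ∩ B₀))
    μₛ-avoid : ∀ B → Empty (B ∩ S) → μₛ B ≡ μ (B ∪ (S ∩ B₀))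
    μₛ-avoid B empty with nonempty? (B ∩ S)
    ... | yes ne = contradiction ne empty
    ... | no  _  = refl
    μₛ-meet : ∀ B → Nonempty (B ∩ S) → μₛ B ≡ ∞
    μₛ-meet B ne with nonempty? (B ∩ S)
    ... | yes _     = refl
    ... | no  empty = contradiction ne empty
    disjoint : Empty ((∁ S ∩ B₀) ∩ S)
    disjoint (x , x∈) with x∈∁S∩B₀ , x∈S ← x∈p∩q⁻ (∁ S ∩ B₀) S x∈ =
      x∈∁p⇒x∉p (proj₁ (x∈p∩q⁻ (∁ S) B₀ x∈∁S∩B₀)) x∈S

  -- Valuated cocircuits as test vectors.

  cocircuit : Val n → Subset n → Fin n → 𝕋
  cocircuit μ I j = if Vec.lookup I j then ∞ else μ (I ∪ ⁅ j ⁆)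

  cocircuit-∉ : ∀ (μ : Val n) (I : Subset n) {j} → j ∉ I → cocircuit μ I j ≡ μ (I ∪ ⁅ j ⁆)
  cocircuit-∉ μ I j∉I rewrite ∉⇒lookup j∉I = refl

  cocircuit-finite : ∀ (μ : Val n) (I : Subset n) {j} → cocircuit μ I j ≢ ∞ → j ∉ I
  cocircuit-finite μ I h j∈I rewrite []=⇒lookup j∈I = h refl

  -- The circuit condition on `K` is the incidence relation for `I` and `K` with its factors
  -- swapped; the value `∞` on `I` removes the indices that the relation omits.
  cocircuit-vector : ∀ (μ : Val n) {I} → Incidence r s ⊥ μ ν → suc ∣ I ∣ ≡ r → IsVector s ν (cocircuit μ I)
  cocircuit-vector {ν = ν} μ {I} inc ∣I∣ .balanced K ∣K∣ a a∈K fa =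
    let b , b≢a , (b∈K , b∉I , _) , le = inc I K ∣I∣ ∣K∣ a (a∈K , a∉I , ∉⊥) (fa ∘ trans (sym (term a∉I)))
    in b , b≢a , b∈K , subst₂ _≤T_ (term b∉I) (term a∉I) le
    where
    a∉I = cocircuit-finite μ I (⊙-finiteʳ {ν (K - a)} fa)
    term : ∀ {j} → j ∉ I → μ (I ∪ ⁅ j ⁆) ⊙ ν (K - j) ≡ ν (K - j) ⊙ cocircuit μ I j
    term {j} j∉I = trans (⊙-comm _ (ν (K - j))) (cong (ν (K - j) ⊙_) (sym (cocircuit-∉ μ I j∉I)))

  -- The containment is tested on the cocircuit of `I`. Projection puts `∞` on `S` as well, so only
  -- indices of `J` outside `I ∪ S` can carry finite terms.
  projectsInto⇒incidence : ∀ (μ ν : Val n) → Incidence r r ⊥ μ μ → ProjectsInto r s S μ ν →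
                           Incidence r s S μ ν
  projectsInto⇒incidence {S = S} μ ν self h I J ∣I∣ ∣J∣ a (a∈J , a∉I , a∉S) fa =
    let b , b≢a , b∈J , le = h (cocircuit μ I) (cocircuit-vector μ self ∣I∣) .balanced J ∣J∣ a a∈J
                               (fa ∘ trans (term a∉I a∉S))
        yb≢∞ = ⊙-finiteʳ {ν (J - b)} (≤T-finite le (fa ∘ trans (term a∉I a∉S)))
        b∉S  = prTrop-finite S (cocircuit μ I) yb≢∞
        b∉I  = cocircuit-finite μ I (yb≢∞ ∘ trans (prTrop-∉ S (cocircuit μ I) b∉S))
    in b , b≢a , (b∈J , b∉I , b∉S) , subst₂ _≤T_ (sym (term b∉I b∉S)) (sym (term a∉I a∉S)) le
    where
    term : ∀ {j} → j ∉ I → j ∉ S →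
      μ (I ∪ ⁅ j ⁆) ⊙ ν (J - j) ≡ ν (J - j) ⊙ prTrop S (cocircuit μ I) j
    term {j} j∉I j∉S = trans (⊙-comm _ (ν (J - j))) (cong (ν (J - j) ⊙_)
      (sym (trans (prTrop-∉ S (cocircuit μ I) j∉S) (cocircuit-∉ μ I j∉I))))

  -- Optimal bases, and passage of vectors along a quotient.

  open SubsetSum ℕ.+-0-commutativeMonoid using () renaming (∑ to ∑ℕ; ∑-insert to ∑ℕ-insert)
  open SubsetSum (CommutativeRing.+-commutativeMonoid realRing) using (∑; ∑-insert)

  +-cancelʳ-≤ : ∀ {x y} z → x + z ≤ᴿ y + z → x ≤ᴿ y
  +-cancelʳ-≤ {x} {y} z le = subst₂ _≤ᴿ_ (cancel x) (cancel y) (+-monoˡ-≤ (- z) le)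
    where
    cancel : ∀ a → a + z + - z ≡ a
    cancel a = trans (+-assoc a z (- z)) (trans (cong (a +_) (-‿inverseʳ z)) (+-identityʳ a))

  private
    -- The ring solver does not cancel over an abstract ring, so a and - a enter it as
    -- independent variables and their sum is replaced by 0# by hand.
    pivot-≤ : ∀ p q a b w → q + b ≤ᴿ p + a → q + (- a + w) ≤ᴿ p + (- b + w)
    pivot-≤ p q a b w le = +-cancelʳ-≤ (a + b)
      (subst₂ _≤ᴿ_ (eq q a b) (trans (eq p b a) (cong (p + (- b + w) +_) (+-comm b a)))
        (+-monoˡ-≤ (0# + w) le))
      where
      eq : ∀ q a b → q + b + (0# + w) ≡ q + (- a + w) + (a + b)
      eq q a b = trans (cong (λ z → q + b + (z + w)) (sym (-‿inverseˡ a)))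
        (solve 5 (λ q a a⁻ b w → q :+ b :+ (a⁻ :+ a :+ w) := q :+ (a⁻ :+ w) :+ (a :+ b)) refl
          q a (- a) b w)

    -- Adding `p + q + w + - a + - b` to both sides of the claim turns it into the sum of the two
    -- hypotheses.
    compare-≤ : ∀ p q a b w t s → p + (- a + w) ≤ᴿ q + (- b + w) → q + s ≤ᴿ p + t → s + b ≤ᴿ t + a
    compare-≤ p q a b w t s le₁ le₂ = +-cancelʳ-≤ (p + q + w + - a + - b)
      (subst₂ _≤ᴿ_
        (trans (cong (p + (- a + w) + (q + s) +_) (sym (-‿inverseˡ b)))
          (solve 7 (λ p q s a⁻ b b⁻ w → p :+ (a⁻ :+ w) :+ (q :+ s) :+ (b⁻ :+ b)
            := s :+ b :+ (p :+ q :+ w :+ a⁻ :+ b⁻)) refl p q s (- a) b (- b) w))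
        (trans (cong (q + (- b + w) + (p + t) +_) (sym (-‿inverseˡ a)))
          (solve 7 (λ p q t a a⁻ b⁻ w → q :+ (b⁻ :+ w) :+ (p :+ t) :+ (a⁻ :+ a)
            := t :+ a :+ (p :+ q :+ w :+ a⁻ :+ b⁻)) refl p q t a (- a) (- b) w))
        (+-monoˡ-≤ 0# (+-mono-≤ le₁ le₂)))

  -- Minimising δ B - Σ_{i ∈ B} yᵢ with infinite yᵢ dominating lexicographically: first as few
  -- finite coordinates as possible, then the finite part.
  module Optimal {n} (k : ℕ) (δ : Val n) (y : Fin n → 𝕋) where

    finiteCount : 𝕋 → ℕ
    finiteCount (fin _) = 1
    finiteCount ∞       = 0

    -- The value at `∞` is a placeholder: infinite coordinates are accounted for by `#finite`, and
    -- weights are compared only between sets with equal `#finite`.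
    negated : 𝕋 → ℝ
    negated (fin a) = - a
    negated ∞       = 0#

    #finite : Subset n → ℕ
    #finite = ∑ℕ (finiteCount ∘ y)

    weight : Subset n → 𝕋
    weight B = δ B ⊙ fin (∑ (negated ∘ y) B)

    -- `fewest` is confined to bases, as a non-basis may have fewer finite coordinates; `lightest`
    -- can range over all `k`-sets, as a non-basis has weight `∞`.
    record IsOptimal (B : Subset n) : Set where
      field
        size       : ∣ B ∣ ≡ k
        finite     : δ B ≢ ∞
        fewest     : ∀ B′ → ∣ B′ ∣ ≡ k → δ B′ ≢ ∞ → #finite B ℕ.≤ #finite B′
        lightest   : ∀ B′ → ∣ B′ ∣ ≡ k → #finite B′ ≡ #finite B → weight B ≤T weight B′

    open IsOptimal

    -- `B₁` minimises the count among bases, `B₂` the weight among `k`-sets with the same count.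
    -- Since `B₁` competes in the second round with finite weight, `B₂` is a basis.
    optimal-exists : (∃ λ B → ∣ B ∣ ≡ k × δ B ≢ ∞) → ∃ IsOptimal
    optimal-exists basis
      with B₁ , (∣B₁∣ , δB₁) , min₁ ← minimiser ℕ.≤-totalOrder #finite
             (λ B → (∣ B ∣ ℕ.≟ k) ×-dec ¬? (≡∞? (δ B))) (subsets n) ∈-subsets basis
      with B₂ , (∣B₂∣ , #B₂) , min₂ ← minimiser ≤T-totalOrder weight
             (λ B → (∣ B ∣ ℕ.≟ k) ×-dec (#finite B ℕ.≟ #finite B₁)) (subsets n) ∈-subsets
             (B₁ , ∣B₁∣ , refl) =
      B₂ , record
        { size     = ∣B₂∣
        ; finite   = ⊙-finiteˡ (≤T-finite (min₂ B₁ (∣B₁∣ , refl)) (⊙-finite δB₁ λ ()))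
        ; fewest   = λ B′ ∣B′∣ δB′ → subst (ℕ._≤ #finite B′) (sym #B₂) (min₁ B′ (∣B′∣ , δB′))
        ; lightest = λ B′ ∣B′∣ #B′ → min₂ B′ (∣B′∣ , trans #B′ #B₂) }

    -- Subtracting `y a`, `y b` and the finite coordinates in `A` from both sides of the inequality
    -- gives the comparison of weights.
    pivot-weight : ∀ {A a b} → a ∉ A → b ∉ A → y a ≢ ∞ → y b ≢ ∞ →
      δ (A ∪ ⁅ a ⁆) ⊙ y b ≤T δ (A ∪ ⁅ b ⁆) ⊙ y a → δ (A ∪ ⁅ b ⁆) ≢ ∞ →
      weight (A ∪ ⁅ a ⁆) ≤T weight (A ∪ ⁅ b ⁆)
    pivot-weight {A} {a} {b} a∉A b∉A ya≢∞ yb≢∞ le δ≢∞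
      rewrite ∑-insert (negated ∘ y) a∉A | ∑-insert (negated ∘ y) b∉A =
      pivot (δ (A ∪ ⁅ b ⁆)) (δ (A ∪ ⁅ a ⁆)) (y a) (y b) δ≢∞ ya≢∞ yb≢∞ le
      where
      pivot : ∀ p q ya yb {w} → p ≢ ∞ → ya ≢ ∞ → yb ≢ ∞ → q ⊙ yb ≤T p ⊙ ya →
        q ⊙ fin (negated ya + w) ≤T p ⊙ fin (negated yb + w)
      pivot ∞ _ _ _ p _ _ _ = contradiction refl p
      pivot _ _ ∞ _ _ a _ _ = contradiction refl a
      pivot _ _ _ ∞ _ _ b _ = contradiction refl b
      pivot (fin p) (fin q) (fin a) (fin b) {w} _ _ _ (fin≤fin le) = fin≤fin (pivot-≤ p q a b w le)

    #finite-insert : ∀ {A a b} → a ∉ A → b ∉ A → y a ≢ ∞ → y b ≢ ∞ →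
      #finite (A ∪ ⁅ a ⁆) ≡ #finite (A ∪ ⁅ b ⁆)
    #finite-insert {A} {a} {b} a∉A b∉A ya≢∞ yb≢∞
      rewrite ∑ℕ-insert (finiteCount ∘ y) a∉A | ∑ℕ-insert (finiteCount ∘ y) b∉A
      with y a | y b
    ... | ∞     | _     = contradiction refl ya≢∞
    ... | fin _ | ∞     = contradiction refl yb≢∞
    ... | fin _ | fin _ = refl

    -- If `a ∉ B`, the circuit condition on `B ∪ ⁅ a ⁆` has the finite term `δ B ⊙ y a` at `a`. A
    -- term at `b` that undercuts it forces `y b` to be finite, so replacing `b` by `a` keeps the
    -- count and does not raise the weight.
    optimal-through : IsVector k δ y → ∃ IsOptimal → ∀ a → y a ≢ ∞ → ∃ λ B → IsOptimal B × a ∈ B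
    optimal-through vy (B , opt) a ya≢∞ with a ∈? B
    ... | yes a∈B = B , opt , a∈B
    ... | no  a∉B
      with b , b≢a , b∈B∪a , le ← vy .balanced (B ∪ ⁅ a ⁆) (trans (∣insert∣ a∉B) (cong suc (opt .size)))
             a x∈p∪⁅x⁆ (subst (λ X → δ X ⊙ y a ≢ ∞) (sym (insert-remove a∉B)) (⊙-finite (opt .finite) ya≢∞)) =
      B′ , record
        { size     = trans (∣exchange∣ b∈B a∉B) (opt .size)
        ; finite   = ⊙-finiteˡ (≤T-finite le′ δB⊙ya)
        ; fewest   = λ C ∣C∣ δC → subst (ℕ._≤ #finite C) #B≡#B′ (opt .fewest C ∣C∣ δC)
        ; lightest = λ C ∣C∣ #C → ≤T-trans weight-B′ (opt .lightest C ∣C∣ (trans #C (sym #B≡#B′))) } ,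
      x∈p∪⁅x⁆
      where
      A B′ : Subset n
      A  = B - b
      B′ = A ∪ ⁅ a ⁆
      b∈B : b ∈ B
      b∈B = x∈p∪⁅y⁆∧x≢y⇒x∈p b∈B∪a b≢a
      A∪b : A ∪ ⁅ b ⁆ ≡ B
      A∪b = remove-insert b∈B
      a∉A : a ∉ A
      a∉A = a∉B ∘ x∈p-y⇒x∈p
      b∉A : b ∉ A
      b∉A = x∉p-x {p = B}
      δB⊙ya : δ B ⊙ y a ≢ ∞
      δB⊙ya = ⊙-finite (opt .finite) ya≢∞
      le′ : δ B′ ⊙ y b ≤T δ B ⊙ y a
      le′ = subst₂ (λ X Y → δ X ⊙ y b ≤T δ Y ⊙ y a)
              (∪-remove B ⁅ a ⁆ (b≢a ∘ x∈⁅y⁆⇒x≡y a)) (insert-remove a∉B) le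
      yb≢∞ : y b ≢ ∞
      yb≢∞ = ⊙-finiteʳ {δ B′} (≤T-finite le′ δB⊙ya)
      #B≡#B′ : #finite B ≡ #finite B′
      #B≡#B′ = trans (cong #finite (sym A∪b)) (#finite-insert b∉A a∉A yb≢∞ ya≢∞)
      weight-B′ : weight B′ ≤T weight B
      weight-B′ = subst (λ X → weight B′ ≤T weight X) A∪b
        (pivot-weight a∉A b∉A ya≢∞ yb≢∞ (subst (λ X → δ B′ ⊙ y b ≤T δ X ⊙ y a) (sym A∪b) le′)
          (opt .finite ∘ trans (cong δ (sym A∪b))))

    -- `s` and `t` stand for values of `ν`. The hypothesis is an exchange inequality; added to the
    -- comparison of weights given by optimality, it loses its values of `δ`.
    optimal-compare : ∀ {A a b s t} → IsOptimal (A ∪ ⁅ a ⁆) → a ∉ A → b ∉ A → y a ≢ ∞ → t ≢ ∞ →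
      δ (A ∪ ⁅ b ⁆) ⊙ s ≤T δ (A ∪ ⁅ a ⁆) ⊙ t → s ⊙ y b ≤T t ⊙ y a
    optimal-compare {A} {a} {b} {s} {t} opt a∉A b∉A ya≢∞ t≢∞ le =
      compare (δ (A ∪ ⁅ a ⁆)) (δ (A ∪ ⁅ b ⁆)) s t (y a) (y b) (opt .finite) t≢∞ ya≢∞ yb≢∞
        (subst₂ (λ u v → δ (A ∪ ⁅ a ⁆) ⊙ fin u ≤T δ (A ∪ ⁅ b ⁆) ⊙ fin v)
          (∑-insert (negated ∘ y) a∉A) (∑-insert (negated ∘ y) b∉A)
          (opt .lightest _ size-b (#finite-insert b∉A a∉A yb≢∞ ya≢∞))) le
      where
      δb≢∞ : δ (A ∪ ⁅ b ⁆) ≢ ∞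
      δb≢∞ = ⊙-finiteˡ (≤T-finite le (⊙-finite (opt .finite) t≢∞))
      size-b : ∣ A ∪ ⁅ b ⁆ ∣ ≡ k
      size-b = trans (trans (∣insert∣ b∉A) (sym (∣insert∣ a∉A))) (opt .size)
      yb≢∞ : y b ≢ ∞
      -- If `y b` were `∞`, the basis `A ∪ ⁅ b ⁆` would have one finite coordinate fewer than the
      -- optimal `A ∪ ⁅ a ⁆`.
      yb≢∞ eq with few ← opt .fewest (A ∪ ⁅ b ⁆) size-b δb≢∞
        rewrite ∑ℕ-insert (finiteCount ∘ y) a∉A | ∑ℕ-insert (finiteCount ∘ y) b∉A | eq
        with y a
      ... | ∞     = ya≢∞ refl
      ... | fin _ = ℕ.<-irrefl refl few
      compare : ∀ p q s t ya yb {w} → p ≢ ∞ → t ≢ ∞ → ya ≢ ∞ → yb ≢ ∞ →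
        p ⊙ fin (negated ya + w) ≤T q ⊙ fin (negated yb + w) → q ⊙ s ≤T p ⊙ t → s ⊙ yb ≤T t ⊙ ya
      compare ∞ _ _ _ _ _ p _ _ _ _ _ = contradiction refl p
      compare _ _ _ ∞ _ _ _ t _ _ _ _ = contradiction refl t
      compare _ _ _ _ ∞ _ _ _ a _ _ _ = contradiction refl a
      compare _ _ _ _ _ ∞ _ _ _ b _ _ = contradiction refl b
      compare (fin p) (fin q) (fin s) (fin t) (fin a) (fin b) {w} _ _ _ _ (fin≤fin le₁) (fin≤fin le₂) =
        fin≤fin (compare-≤ p q a b w t s le₁ le₂)

  quotient⇒vector : ∀ (δ ν : Val n) {y} → (∃ λ B → ∣ B ∣ ≡ k × δ B ≢ ∞) → Quotient k s δ ν →
                    IsVector k δ y → IsVector s ν y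
  quotient⇒vector {k = k} δ ν {y} basis quot vy .balanced J ∣J∣ a a∈J fa
    with B , opt , a∈B ← Optimal.optimal-through k δ y vy (Optimal.optimal-exists k δ y basis) a
           (⊙-finiteʳ {ν (J - a)} fa)
    with b , b∈J-a , b∉B , le ← quot B (J - a) a (Optimal.IsOptimal.size opt)
           (ℕ.suc-injective (trans (∣remove∣ a∈J) ∣J∣)) a∈B (x∉p-x {p = J}) =
    b , x∈p-y⇒x≢y b∈J-a , x∈p-y⇒x∈p b∈J-a ,
    -- Here `s` is `ν (J - b)` and `t` is `ν (J - a)`.
    Optimal.optimal-compare k δ y {A = B - a} (subst (Optimal.IsOptimal k δ y) (sym B≡) opt)
      (x∉p-x {p = B}) (b∉B ∘ x∈p-y⇒x∈p) (⊙-finiteʳ {ν (J - a)} fa) (⊙-finiteˡ fa)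
      (subst₂ _≤T_ (cong (δ ((B - a) ∪ ⁅ b ⁆) ⊙_) (cong ν J≡)) (cong (λ X → δ X ⊙ ν (J - a)) (sym B≡)) le)
    where
    B≡ = remove-insert a∈B
    J≡ : ((J - a) - b) ∪ ⁅ a ⁆ ≡ J - b
    J≡ = trans (cong (_∪ ⁅ a ⁆) (p─x─y≡p─y─x J a b))
               (remove-insert (x∈p∧x≢y⇒x∈p-y a∈J (x∈p-y⇒x≢y b∈J-a ∘ sym)))

  -- Loops, and projections as morphisms.

  quotient-loop⁺ : ∀ (δ ν : Val n) → r ℕ.≤ s → Quotient r s δ ν → Quotient r s (loopExt δ) (loopExt ν)
  quotient-loop⁺ {r = r} {s} δ ν r≤s h = Quotient-intro (loopExt δ) (loopExt ν) r≤s go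
    where
    go : ∀ I J i → ∣ I ∣ ≡ r → ∣ J ∣ ≡ s → i ∈ I → i ∉ J → loopExt δ I ⊙ loopExt ν J ≢ ∞ →
      ∃ λ j → j ∈ J × j ∉ I ×
        (loopExt δ ((I - i) ∪ ⁅ j ⁆) ⊙ loopExt ν ((J - j) ∪ ⁅ i ⁆) ≤T loopExt δ I ⊙ loopExt ν J)
    -- A set containing the loop has value `∞`, so in the finite case the exchange takes place among
    -- the old elements.
    go (inside ∷ I)  J             i _ _ _ _ finite = contradiction refl finite
    go (outside ∷ I) (inside ∷ J)  i _ _ _ _ finite = contradiction (⊙-zeroʳ (δ I)) finite
    go (outside ∷ I) (outside ∷ J) (suc i) ∣I∣ ∣J∣ (there i∈I) i∉J _
      with j , j∈J , j∉I , le ← h I J i ∣I∣ ∣J∣ i∈I (i∉J ∘ there) =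
      suc j , there j∈J , (λ { (there j∈I) → j∉I j∈I }) , le

  quotient-loop⁻ : ∀ (δ ν : Val n) → Quotient r s (loopExt δ) (loopExt ν) → Quotient r s δ ν
  quotient-loop⁻ δ ν h I J i ∣I∣ ∣J∣ i∈I i∉J
    with h (outside ∷ I) (outside ∷ J) (suc i) ∣I∣ ∣J∣ (there i∈I) (λ { (there i∈J) → i∉J i∈J })
  ... | suc j , there j∈J , j∉I , le = j , j∈J , j∉I ∘ there , le

  ∣∷∩outside∷∣ : ∀ b (S B : Subset n) → ∣ (b ∷ S) ∩ (outside ∷ B) ∣ ≡ ∣ S ∩ B ∣
  ∣∷∩outside∷∣ b S B rewrite ∧-zeroʳ b = refl

  -- Bases of `loopExt μ` avoid the loop, so the bit `b` does not affect the rank.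
  hasRank-loop⁺ : ∀ (μ : Val n) {S b} → HasRank r μ S k → HasRank r (loopExt μ) (b ∷ S) k
  hasRank-loop⁺ μ {S} {b} ((B , basis , ∣S∩B∣) , bound) =
    (outside ∷ B , basis , trans (∣∷∩outside∷∣ b S B) ∣S∩B∣) , λ where
      (inside ∷ B′)  (_ , h)   → contradiction refl h
      (outside ∷ B′) basis′ → subst (ℕ._≤ _) (sym (∣∷∩outside∷∣ b S B′)) (bound B′ basis′)

  hasRank-loop⁻ : ∀ (μ : Val n) {S b} → HasRank r (loopExt μ) (b ∷ S) k → HasRank r μ S k
  hasRank-loop⁻ μ         ((inside ∷ B , (_ , h) , _) , _) = contradiction refl h
  hasRank-loop⁻ μ {S} {b} ((outside ∷ B , basis , ∣S∩B∣) , bound) =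
    (B , basis , trans (sym (∣∷∩outside∷∣ b S B)) ∣S∩B∣) , λ B′ basis′ →
      subst (ℕ._≤ _) (∣∷∩outside∷∣ b S B′) (bound (outside ∷ B′) basis′)

  isMuS-loop⁺ : ∀ (μ δ : Val n) S → IsMuS r μ S k δ → IsMuS r (loopExt μ) (outside ∷ S) k (loopExt δ)
  isMuS-loop⁺ μ δ S (rank , I₀ , I₀⊆S , ∣I₀∣ , full , avoid , meet) =
    hasRank-loop⁺ μ rank , outside ∷ I₀ , (λ { (there x∈) → there (I₀⊆S x∈) }) , ∣I₀∣ ,
    hasRank-loop⁺ μ full ,
    (λ where
      (inside ∷ B)  _     → refl
      (outside ∷ B) empty → avoid B λ (x , x∈) → empty (suc x , there x∈)) ,
    λ where
      (inside ∷ B)  _                  → refl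
      (outside ∷ B) (suc x , there x∈) → meet B (x , x∈)

  isMuS-loop⁻ : ∀ (μ : Val n) δ S → IsMuS r (loopExt μ) (outside ∷ S) k δ →
                IsMuS r μ S k (δ ∘ (outside ∷_))
  isMuS-loop⁻ μ δ S (_ , inside ∷ I₀ , I₀⊆S , _) with () ← I₀⊆S here
  isMuS-loop⁻ μ δ S (rank , outside ∷ I₀ , I₀⊆S , ∣I₀∣ , full , avoid , meet) =
    hasRank-loop⁻ μ rank , I₀ , drop-∷-⊆ I₀⊆S , ∣I₀∣ , hasRank-loop⁻ μ full ,
    (λ B empty → avoid (outside ∷ B) λ { (suc x , there x∈) → empty (x , x∈) }) ,
    λ B (x , x∈) → meet (outside ∷ B) (suc x , there x∈)

  -- The element `o` is not deleted and remains a loop: either clause of `IsMuS` gives `∞`, the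
  -- avoiding one because `loopExt μ` is evaluated on a set containing `o`.
  isMuS-loop-inside : ∀ (μ : Val n) δ S → IsMuS r (loopExt μ) (outside ∷ S) k δ →
                      ∀ B → δ (inside ∷ B) ≡ ∞
  isMuS-loop-inside μ δ S (_ , (_ ∷ _) , _ , _ , _ , avoid , meet) B
    with nonempty? ((inside ∷ B) ∩ (outside ∷ S))
  ... | yes ne   = meet _ ne
  ... | no empty = avoid _ empty

  image⁺ : ∀ {m n} (f : Fin m → Fin n) {I i} → i ∈ I → f i ∈ image f I
  image⁺ f {I} {i} i∈I = lookup⇒[]= (f i) _
    (trans (lookup∘tabulate _ (f i)) (trans (isYes≗does (any? _)) (dec-true (any? _) (i , i∈I , refl))))

  image⁻ : ∀ {m n} (f : Fin m → Fin n) {I j} → j ∈ image f I → ∃ λ i → i ∈ I × f i ≡ j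
  image⁻ f {I} {j} j∈ with any? (λ i → (i ∈? I) ×-dec (f i ≟ j)) in eq
  ... | yes h = h
  ... | no  _ with () ← trans (sym (trans (lookup∘tabulate _ j) (cong ⌊_⌋ eq))) ([]=⇒lookup j∈)

  prMap-∉ : ∀ (S : Subset n) {i} → i ∉ S → prMap S (suc i) ≡ suc i
  prMap-∉ S i∉S rewrite ∉⇒lookup i∉S = refl

  prMap-∈ : ∀ (S : Subset n) {i} → i ∈ S → prMap S (suc i) ≡ zero
  prMap-∈ S i∈S rewrite []=⇒lookup i∈S = refl

  -- `o` and the elements outside `S` are their own images, while nothing maps into `S`. So the
  -- restriction in `IsMorphism` deletes exactly `S`.
  ∁-image-prMap : ∀ (S : Subset n) → ∁ (image (prMap S) ⊤) ≡ outside ∷ S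
  ∁-image-prMap S = ⊆-antisym to from
    where
    to : ∁ (image (prMap S) ⊤) ⊆ outside ∷ S
    to {zero}  h = contradiction (image⁺ (prMap S) {i = zero} ∈⊤) (x∈∁p⇒x∉p h)
    to {suc i} h with i ∈? S
    ... | yes i∈S = there i∈S
    ... | no  i∉S = contradiction (subst (_∈ image (prMap S) ⊤) (prMap-∉ S i∉S) (image⁺ (prMap S) ∈⊤))
                                  (x∈∁p⇒x∉p h)
    hit : ∀ {i} → i ∈ S → suc i ∉ image (prMap S) ⊤
    hit {i} i∈S h with image⁻ (prMap S) h
    ... | zero  , _ , ()
    ... | suc j , _ , eq with j ∈? S
    ...   | yes j∈S with () ← trans (sym (prMap-∈ S j∈S)) eq
    ...   | no  j∉S with refl ← trans (sym (prMap-∉ S j∉S)) eq = j∉S i∈S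
    from : outside ∷ S ⊆ ∁ (image (prMap S) ⊤)
    from (there i∈S) = x∉p⇒x∈∁p (hit i∈S)

  image-prMap-avoid : ∀ (S : Subset n) {B} → Empty (B ∩ S) → image (prMap S) (outside ∷ B) ≡ outside ∷ B
  image-prMap-avoid S {B} empty = ⊆-antisym to from
    where
    B∩S : ∀ {i} → i ∈ B → i ∉ S
    B∩S i∈B i∈S = empty (_ , x∈p∩q⁺ (i∈B , i∈S))
    to : image (prMap S) (outside ∷ B) ⊆ outside ∷ B
    to h with suc i , there i∈B , refl ← image⁻ (prMap S) h =
      subst (_∈ outside ∷ B) (sym (prMap-∉ S (B∩S i∈B))) (there i∈B)
    from : outside ∷ B ⊆ image (prMap S) (outside ∷ B)
    from (there i∈B) = subst (_∈ image (prMap S) (outside ∷ B)) (prMap-∉ S (B∩S i∈B))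
                         (image⁺ (prMap S) (there i∈B))

  preimage-∞ : ∀ {m n} k (f : Fin m → Fin n) δ I → δ (image f I) ≡ ∞ → preimage k f δ I ≡ ∞
  preimage-∞ k f δ I eq with (∣ image f I ∣ ℕ.≡ᵇ ∣ I ∣) ∧ (∣ image f I ∣ ℕ.≡ᵇ k)
  ... | true  = eq
  ... | false = refl

  ≡ᵇ-refl : ∀ m → (m ℕ.≡ᵇ m) ≡ true
  ≡ᵇ-refl zero    = refl
  ≡ᵇ-refl (suc m) = ≡ᵇ-refl m

  preimage-fixed : ∀ {n} {k} (f : Fin n → Fin n) δ {I} → image f I ≡ I → ∣ I ∣ ≡ k → preimage k f δ I ≡ δ I
  preimage-fixed f δ {I} eq refl rewrite eq | ≡ᵇ-refl ∣ I ∣ = refl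

  -- If `I` contains `o` or meets `S`, its image contains `o` and both sides are `∞`; otherwise the
  -- projection fixes `I`.
  preimage-prMap : ∀ (μ : Val n) δ S → IsMuS r (loopExt μ) (outside ∷ S) k δ → ∀ I → ∣ I ∣ ≡ k →
    preimage k (prMap S) δ I ≡ loopExt (δ ∘ (outside ∷_)) I
  preimage-prMap {k = k} μ δ S isMuS I ∣I∣ = go I ∣I∣
    where
    δ-zero : ∀ B → zero ∈ B → δ B ≡ ∞
    δ-zero (inside ∷ B) _ = isMuS-loop-inside μ δ S isMuS B
    go : ∀ I → ∣ I ∣ ≡ k → preimage k (prMap S) δ I ≡ loopExt (δ ∘ (outside ∷_)) I
    go (inside ∷ I) _ = preimage-∞ k (prMap S) δ _ (δ-zero _ (image⁺ (prMap S) {i = zero} here))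
    go (outside ∷ I) ∣I∣ with nonempty? (I ∩ S)
    ... | no  empty = preimage-fixed (prMap S) δ (image-prMap-avoid S empty) ∣I∣
    ... | yes (x , x∈) with x∈I , x∈S ← x∈p∩q⁻ I S x∈ = trans
      (preimage-∞ k (prMap S) δ _ (δ-zero _
        (subst (_∈ image (prMap S) (outside ∷ I)) (prMap-∈ S x∈S) (image⁺ (prMap S) (there x∈I)))))
      (sym (proj₂ (proj₂ (proj₂ (proj₂ (proj₂ (proj₂ isMuS))))) (outside ∷ I)
        (suc x , there x∈)))

  quotient⇒morphism : ∀ (μ ν : Val n) S → r ℕ.≤ s → (∀ k δ → IsMuS r μ S k δ → Quotient k s δ ν) →
                      IsMorphism (prMap S) s ν r μ
  quotient⇒morphism {r = r} μ ν S r≤s h = refl , λ k δ isMuS′ →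
    let isMuS = subst (λ T → IsMuS r (loopExt μ) T k δ) (∁-image-prMap S) isMuS′
        isMuS⁻ = isMuS-loop⁻ μ δ S isMuS
    in Quotient-congˡ (loopExt ν) (λ I ∣I∣ → sym (preimage-prMap μ δ S isMuS I ∣I∣))
         (quotient-loop⁺ (δ ∘ (outside ∷_)) ν (ℕ.≤-trans (HasRank-≤ μ (∁ S) (proj₁ isMuS⁻)) r≤s)
           (h k _ isMuS⁻))

  morphism⇒quotient : ∀ (μ ν : Val n) S → IsMorphism (prMap S) s ν r μ →
                      ∀ k δ → IsMuS r μ S k δ → Quotient k s δ ν
  morphism⇒quotient {r = r} μ ν S (_ , h) k δ isMuS =
    quotient-loop⁻ δ ν (Quotient-congˡ (loopExt ν) (preimage-prMap μ (loopExt δ) S isMuS⁺)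
      (h k (loopExt δ) (subst (λ T → IsMuS r (loopExt μ) T k (loopExt δ)) (sym (∁-image-prMap S)) isMuS⁺)))
    where isMuS⁺ = isMuS-loop⁺ μ δ S isMuS

  -- From consecutive pairs to the whole flag.

  quotients⇒projectsInto : ∀ (μ ν : Val n) S → (∃ λ I → ∣ I ∣ ≡ r × μ I ≢ ∞) →
    (∀ k δ → IsMuS r μ S k δ → Quotient k s δ ν) → ProjectsInto r s S μ ν
  quotients⇒projectsInto μ ν S basis h x vx
    -- The hypothesis speaks of every deletion, so one has to be exhibited; vectors of `μ` project
    -- to vectors of `δ`, which the quotient makes vectors of `ν`.
    with k , δ , isMuS , basisδ ← deletion-exists μ S basis =
    quotient⇒vector δ ν basisδ (h k δ isMuS) (Deletion.projectsInto μ δ S isMuS x vx)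

  module _ {m n} (S : Fin m → Subset n) where

    x∈Sunion⁺ : ∀ {i j x l} → toℕ i ℕ.≤ toℕ l → toℕ l ℕ.< toℕ j → x ∈ S l → x ∈ Sunion S i j
    x∈Sunion⁺ i≤l l<j x∈Sl = x∈⋃⁺ (∈-map⁺ S (∈-filter⁺ _ (∈-allFin _) (i≤l , l<j))) x∈Sl

    x∈Sunion⁻ : ∀ i j {x} → x ∈ Sunion S i j → ∃ λ l → toℕ i ℕ.≤ toℕ l × toℕ l ℕ.< toℕ j × x ∈ S l
    x∈Sunion⁻ i j x∈ with p , p∈ , x∈p ← x∈⋃⁻ _ x∈
      with l , l∈ , refl ← ∈-map⁻ S p∈
      with _ , i≤l , l<j ← ∈-filter⁻ (λ l → (toℕ i ℕ.≤? toℕ l) ×-dec (toℕ l ℕ.<? toℕ j)) {xs = allFin m} l∈ =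
      l , i≤l , l<j , x∈p

    Sunion-refl : ∀ i → Sunion S i i ≡ ⊥
    Sunion-refl i = ⊆-antisym
      (λ x∈ → let _ , i≤l , l<i , _ = x∈Sunion⁻ i i x∈ in contradiction i≤l (ℕ.<⇒≱ l<i))
      (λ x∈⊥ → contradiction x∈⊥ ∉⊥)

    -- An index below `j + 1` is below `j` or equal to `j`; as positions in the flag, these two
    -- bounds are `suc j` and `inject₁ j`.
    Sunion-suc : ∀ i j → toℕ i ℕ.≤ toℕ j → Sunion S i (suc j) ≡ Sunion S i (inject₁ j) ∪ S j
    Sunion-suc i j i≤j = ⊆-antisym to from
      where
      to : Sunion S i (suc j) ⊆ Sunion S i (inject₁ j) ∪ S j
      to x∈ with l , i≤l , s≤s l≤j , x∈Sl ← x∈Sunion⁻ i (suc j) x∈ with l ≟ j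
      ... | yes refl = q⊆p∪q _ _ x∈Sl
      ... | no  l≢j  = p⊆p∪q _ (x∈Sunion⁺ i≤l
        (subst (toℕ l ℕ.<_) (sym (toℕ-inject₁ j)) (ℕ.≤∧≢⇒< l≤j (l≢j ∘ toℕ-injective))) x∈Sl)
      from : Sunion S i (inject₁ j) ∪ S j ⊆ Sunion S i (suc j)
      from x∈ with x∈p∪q⁻ (Sunion S i (inject₁ j)) (S j) x∈
      ... | inj₂ x∈Sj = x∈Sunion⁺ i≤j ℕ.≤-refl x∈Sj
      ... | inj₁ x∈U with l , i≤l , l<j , x∈Sl ← x∈Sunion⁻ i (inject₁ j) x∈U =
        x∈Sunion⁺ i≤l (ℕ.m<n⇒m<1+n (subst (toℕ l ℕ.<_) (toℕ-inject₁ j) l<j)) x∈Sl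

    Sunion-consecutive : ∀ i → Sunion S (inject₁ i) (suc i) ≡ S i
    Sunion-consecutive i = trans (Sunion-suc (inject₁ i) i (ℕ.≤-reflexive (toℕ-inject₁ i)))
      (trans (cong (_∪ S i) (Sunion-refl (inject₁ i))) (∪-identityˡ (S i)))

    -- Induction on `j`, where successive projections merge by `prTrop-∪`. The chain starts at
    -- `j = i` with an empty union.
    projectsInto-Sunion : ∀ (r : Fin (suc m) → ℕ) (μ : Fin (suc m) → Val n) →
      (∀ i → ProjectsInto (r (inject₁ i)) (r (suc i)) (S i) (μ (inject₁ i)) (μ (suc i))) →
      ∀ i j → toℕ i ℕ.≤ toℕ j → ProjectsInto (r i) (r j) (Sunion S i j) (μ i) (μ j)
    projectsInto-Sunion r μ h i = <-weakInduction P base step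
      where
      P : Fin (suc m) → Set
      P j = toℕ i ℕ.≤ toℕ j → ProjectsInto (r i) (r j) (Sunion S i j) (μ i) (μ j)
      same : ProjectsInto (r i) (r i) (Sunion S i i) (μ i) (μ i)
      same x = IsVector-cong λ j → sym (prTrop-∉ (Sunion S i i) x
        (subst (j ∉_) (sym (Sunion-refl i)) ∉⊥))
      base : P zero
      base i≤0 with refl ← toℕ-injective {i = i} {zero} (ℕ.n≤0⇒n≡0 i≤0) = same
      step : ∀ j → P (inject₁ j) → P (suc j)
      step j IH i≤1+j x vx with toℕ i ℕ.≤? toℕ j
      ... | yes i≤j = IsVector-cong
        (λ a → sym (trans (cong (λ T → prTrop T x a) (Sunion-suc i j i≤j))
                          (prTrop-∪ (Sunion S i (inject₁ j)) (S j) x a)))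
        (h j _ (IH (subst (toℕ i ℕ.≤_) (sym (toℕ-inject₁ j)) i≤j) x vx))
      -- Here `i = j + 1`, so the chain starts at this step and the induction hypothesis says
      -- nothing.
      ... | no  i≰j with refl ← toℕ-injective {i = i} {suc j} (ℕ.≤-antisym i≤1+j (ℕ.≰⇒> i≰j)) = same x vx

theoremA : (R : RealField) → let open Tropical R in
    (m n : ℕ) → 1 ≤ n →
    (r : Fin (suc m) → ℕ) →
    (∀ i → r (inject₁ i) ≤ r (F.suc i)) → r (fromℕ m) ≤ n →
    (S : Fin m → Subset n) →
    (μ : Fin (suc m) → Val n) →
    (∀ i → IsValuatedMatroid (r i) (μ i)) →
    (InLFlDr r S μ ⇔ IsLinDegFlag r S μ) ×
    (InLFlDr r S μ ⇔ ProjContained r S μ) ×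
    (InLFlDr r S μ ⇔ ProjMorphisms r S μ)
theoremA R m n _ r r≤ _ S μ valuated =
  -- The implications proved are (a) ⇒ (b) ⇒ (c) ⇒ (a) and (b) ⇔ (d).
  mk⇔ a⇒b (c⇒a ∘ b⇒c) ,
  mk⇔ (b⇒c ∘ a⇒b) c⇒a ,
  mk⇔ (b⇒d ∘ a⇒b) (c⇒a ∘ b⇒c ∘ d⇒b)
  where
  open Tropical R
  open Theory R

  -- The exchange axiom of `μ i` unfolds to the statement that `μ i` is a quotient of itself.
  self : ∀ i → Incidence (r i) (r i) ⊥ (μ i) (μ i)
  self i = quotient⇒incidence (μ i) (μ i) (proj₂ (valuated i))

  a⇒b : InLFlDr r S μ → IsLinDegFlag r S μ
  a⇒b (_ , h) i k δ isMuS = Deletion.incidence⇒quotient (μ (inject₁ i)) δ (S i) isMuS (μ (suc i)) (r≤ i)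
    (plucker⇒incidence (S i) (μ (inject₁ i)) (μ (suc i))
      (subst (λ T → PluckerHolds (r (inject₁ i)) (r (suc i)) T (μ (inject₁ i)) (μ (suc i)))
        (Sunion-consecutive S i)
        (h (inject₁ i) (suc i) (s≤s (ℕ.≤-reflexive (toℕ-inject₁ i))))))

  b⇒c : IsLinDegFlag r S μ → ProjContained r S μ
  b⇒c h i = projectsInto⇒projTrop {S = S i} (μ (inject₁ i))
    (quotients⇒projectsInto (μ (inject₁ i)) (μ (suc i)) (S i) (proj₁ (valuated (inject₁ i))) (h i))

  c⇒a : ProjContained r S μ → InLFlDr r S μ
  c⇒a h =
    (λ i → incidence⇒plucker ⊥ (μ i) (μ i) (self i)) ,
    λ i j i<j → incidence⇒plucker (Sunion S i j) (μ i) (μ j)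
      (projectsInto⇒incidence (μ i) (μ j) (self i)
        (projectsInto-Sunion S r μ (λ l → projTrop⇒projectsInto {S = S l} (h l)) i j (ℕ.<⇒≤ i<j)))

  b⇒d : IsLinDegFlag r S μ → ProjMorphisms r S μ
  b⇒d h i = quotient⇒morphism (μ (inject₁ i)) (μ (suc i)) (S i) (r≤ i) (h i)

  d⇒b : ProjMorphisms r S μ → IsLinDegFlag r S μ
  d⇒b h i = morphism⇒quotient (μ (inject₁ i)) (μ (suc i)) (S i) (h i)
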